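{- Fix $m,n\in\omega\setminus\{0,1\}$ and $k\in\omega\setminus\{0\}$. The following are provable in $\mathsf{ZF}$: (1) $\mathsf{RRT}^{m}_{n}$ implies $\mathsf{AC}_{2}^{ - }$. (2) $\mathsf{RRT}^{2k+1}_{r}$ implies $\mathsf{AC}_{n}^{ - }$ for all natural numbers $r\geq \binom{n}{2}^{k}\, n\,(k+1)$. (3) $\mathsf{RRT}^{2k}_{r}$ implies $\mathsf{AC}_{n}^{ - }$ for all natural numbers $r\geq \binom{n}{2}^{k-1}\, n^{2}\binom{k+1}{2}$. (4) $\mathsf{RRT}^{2}_{3}$ implies $\mathsf{AC}_{3}^{ - }$.
   Context: $\omega$ is the set of natural numbers; $[X]^{m}$ is the set of $m$-element subsets of $X$. A coloring $\chi:[X]^{m}\to C$ is $n$-bounded if $|\chi^{ -1}[\{c\}]|\leq n$ for each $c\in C$. A set $Z\subseteq X$ is polychromatic for $\chi$ if distinct members of $[Z]^{m}$ receive distinct colors. $\mathsf{RRT}^{m}_{n}$: if $X$ is an infinite set and $\chi:[X]^{m}\to C$ is an $n$-bounded coloring for some infinite set $C$, then there is an infinite set $Y\subseteq X$ which is polychromatic for $\chi$. $\mathsf{AC}_{n}^{ - }$: every infinite family $\mathcal{A}$ of $n$-element sets has an infinite subfamily $\mathcal{B}\subseteq\mathcal{A}$ with a choice function. $\mathsf{ZF}$ is Zermelo–Fraenkel set theory without the Axiom of Choice. -}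

module Defs where

open import Data.Nat using (ℕ; zero; suc; _+_)
open import Data.Fin using (Fin; zero; suc; lift; _↑ʳ_)
open import Data.Fin.Patterns
open import Data.List using (List; []; _∷_; map)
open import Data.List.Membership.Propositional using () renaming (_∈_ to _∈ᴸ_)

private variable
  k n : ℕ

-- First-order logic with equality over the signature {∈}.
-- `Formula n` is the type of formulas whose free variables are among n de
-- Bruijn indices.  The language has no function symbols, so terms are variables.

-- Quantifiers extend as far to the right as possible.
infix  9 _∈_ _≐_ _⊆_ _≈_ _≼_ _∈[_]^_ _≐[_]^_
infixr 6 _∧_
infixr 5 _∨_
infix  3 _⇔_
infixr 2 _⇒_ ∀′_ ∃′_ ∀∈[_]_ ∃∈[_]_

data Formula (n : ℕ) : Set where
  _∈_ _≐_ : Fin n → Fin n → Formula n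
  ⊥′      : Formula n
  _⇒_     : Formula n → Formula n → Formula n
  ∀′_     : Formula (suc n) → Formula n

-- The other connectives are the usual classical abbreviations.

¬′_ : Formula n → Formula n
¬′ φ = φ ⇒ ⊥′

_∧_ _∨_ _⇔_ : Formula n → Formula n → Formula n
φ ∧ ψ = ¬′ (φ ⇒ ¬′ ψ)
φ ∨ ψ = ¬′ φ ⇒ ψ
φ ⇔ ψ = (φ ⇒ ψ) ∧ (ψ ⇒ φ)

∃′_ : Formula (suc n) → Formula n
∃′ φ = ¬′ (∀′ ¬′ φ)

∀∈[_]_ ∃∈[_]_ : Fin n → Formula (suc n) → Formula n
∀∈[ a ] φ = ∀′ (0F ∈ suc a ⇒ φ)
∃∈[ a ] φ = ∃′ (0F ∈ suc a ∧ φ)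

rename : (Fin k → Fin n) → Formula k → Formula n
rename ρ (x ∈ y) = ρ x ∈ ρ y
rename ρ (x ≐ y) = ρ x ≐ ρ y
rename ρ ⊥′      = ⊥′
rename ρ (φ ⇒ ψ) = rename ρ φ ⇒ rename ρ ψ
rename ρ (∀′ φ)  = ∀′ rename (lift 1 ρ) φ

weaken : Formula n → Formula (suc n)
weaken = rename suc

instantiate : Fin n → Fin (suc n) → Fin n
instantiate x zero    = x
instantiate x (suc i) = i

_[_] : Formula (suc n) → Fin n → Formula n
φ [ x ] = rename (instantiate x) φ

Sentence : Set
Sentence = Formula 0

Theory : Set₁
Theory = Sentence → Set

-- Classical natural deduction from the axioms of a theory T.  In a judgement
-- all free variables are among the n in scope, so at n = 0 nothing presupposes
-- that the universe is nonempty; in ZF this follows from the axiom of infinity.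

infix 1 _∣_⊢_ _⊢_

data _∣_⊢_ (T : Theory) {n : ℕ} (Γ : List (Formula n)) : Formula n → Set where
  axiom   : ∀ {φ} → T φ → T ∣ Γ ⊢ rename (λ ()) φ
  assume  : ∀ {φ} → φ ∈ᴸ Γ → T ∣ Γ ⊢ φ
  ⇒-intro : ∀ {φ ψ} → T ∣ φ ∷ Γ ⊢ ψ → T ∣ Γ ⊢ φ ⇒ ψ
  ⇒-elim  : ∀ {φ ψ} → T ∣ Γ ⊢ φ ⇒ ψ → T ∣ Γ ⊢ φ → T ∣ Γ ⊢ ψ
  raa     : ∀ {φ} → T ∣ ¬′ φ ∷ Γ ⊢ ⊥′ → T ∣ Γ ⊢ φ
  ∀-intro : ∀ {φ} → T ∣ map weaken Γ ⊢ φ → T ∣ Γ ⊢ ∀′ φ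
  ∀-elim  : ∀ {φ} → T ∣ Γ ⊢ ∀′ φ → ∀ x → T ∣ Γ ⊢ φ [ x ]
  ≐-refl  : ∀ x → T ∣ Γ ⊢ x ≐ x
  ≐-subst : ∀ φ {x y} → T ∣ Γ ⊢ x ≐ y → T ∣ Γ ⊢ φ [ x ] → T ∣ Γ ⊢ φ [ y ]

_⊢_ : Theory → Sentence → Set
T ⊢ φ = T ∣ [] ⊢ φ

-- Set-theoretic vocabulary.  Inside b quantifiers a parameter x is written
-- b ↑ʳ x, and 0F, 1F, … are the bound variables counted from the innermost.

_⊆_ : Fin n → Fin n → Formula n
x ⊆ y = ∀∈[ x ] 0F ∈ suc y

IsEmpty : Fin n → Formula n
IsEmpty x = ∀′ ¬′ (0F ∈ suc x)

-- z = {x , y}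
IsPair : (z x y : Fin n) → Formula n
IsPair z x y = ∀′ (0F ∈ suc z ⇔ 0F ≐ suc x ∨ 0F ≐ suc y)

-- p = ⟨x , y⟩ = {{x} , {x , y}}
IsOrderedPair : (p x y : Fin n) → Formula n
IsOrderedPair p x y =
  ∃′ ∃′ IsPair 1F (2 ↑ʳ x) (2 ↑ʳ x) ∧ IsPair 0F (2 ↑ʳ x) (2 ↑ʳ y)
      ∧ IsPair (2 ↑ʳ p) 1F 0F

-- y = x ∪ {x}
IsSucc : (y x : Fin n) → Formula n
IsSucc y x = ∀′ (0F ∈ suc y ⇔ 0F ∈ suc x ∨ 0F ≐ suc x)

IsInductive : Fin n → Formula n
IsInductive w = (∃∈[ w ] IsEmpty 0F) ∧ (∀∈[ w ] ∃∈[ suc w ] IsSucc 0F 1F)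

-- The axioms of ZF

closure : ∀ n → Formula n → Sentence
closure zero    φ = φ
closure (suc n) φ = closure n (∀′ φ)

-- φ(x, y) for a formula with distinguished variables x = 1F and y = 0F, moved
-- beneath k further binders over its parameters.
_⟨_,_⟩ : Formula (2 + n) → (x y : Fin (k + n)) → Formula (k + n)
_⟨_,_⟩ {n} {k} φ x y = rename ρ φ
  where
  ρ : Fin (2 + n) → Fin (k + n)
  ρ zero          = y
  ρ (suc zero)    = x
  ρ (suc (suc i)) = k ↑ʳ i

data ZF : Theory where
  extensionality : ZF (∀′ ∀′ (∀′ (0F ∈ 1F ⇔ 0F ∈ 2F)) ⇒ 0F ≐ 1F)
  foundation     : ZF (∀′ (∃′ 0F ∈ 1F) ⇒ ∃∈[ 0F ] ¬′ (∃∈[ 0F ] 0F ∈ 2F))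
  pairing        : ZF (∀′ ∀′ ∃′ IsPair 0F 1F 2F)
  union          : ZF (∀′ ∃′ ∀′ (0F ∈ 1F ⇔ (∃∈[ 2F ] 1F ∈ 0F)))
  powerset       : ZF (∀′ ∃′ ∀′ (0F ∈ 1F ⇔ 0F ⊆ 2F))
  infinity       : ZF (∃′ IsInductive 0F)
  -- For all parameters and all a there is b = {x ∈ a : φ(x)}.
  separation     : ∀ n (φ : Formula (1 + n)) →
                   ZF (closure n
                     (∀′ ∃′ ∀′ (0F ∈ 1F ⇔ 0F ∈ 2F ∧ rename (lift 1 (2 ↑ʳ_)) φ)))
  -- For all parameters and all a, if φ is functional on a then there is
  -- b = {y : φ(x, y) for some x ∈ a}.
  replacement    : ∀ n (φ : Formula (2 + n)) →
                   ZF (closure n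
                     (∀′ (∀∈[ 0F ] ∀′ ∀′ φ ⟨ 2F , 1F ⟩ ⇒ φ ⟨ 2F , 0F ⟩ ⇒ 1F ≐ 0F)
                       ⇒ ∃′ ∀′ (0F ∈ 1F ⇔ (∃∈[ 2F ] φ ⟨ 0F , 1F ⟩))))

-- Functions and cardinality

-- ⟨x , y⟩ ∈ f
Maps : (f x y : Fin n) → Formula n
Maps f x y = ∃∈[ f ] IsOrderedPair 0F (suc x) (suc y)

-- f : A → B
IsFunction : (f A B : Fin n) → Formula n
IsFunction f A B =
    (∀∈[ f ] ∃∈[ suc A ] ∃∈[ 2 ↑ʳ B ] IsOrderedPair 2F 1F 0F)
  ∧ (∀∈[ A ] ∃′ Maps (2 ↑ʳ f) 1F 0F ∧ (∀′ Maps (3 ↑ʳ f) 2F 0F ⇒ 0F ≐ 1F))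

IsInjective : Fin n → Formula n
IsInjective f = ∀′ ∀′ ∀′ Maps (3 ↑ʳ f) 2F 0F ⇒ Maps (3 ↑ʳ f) 1F 0F ⇒ 2F ≐ 1F

IsOnto : (f B : Fin n) → Formula n
IsOnto f B = ∀∈[ B ] ∃′ Maps (2 ↑ʳ f) 0F 1F

_≈_ _≼_ : (A B : Fin n) → Formula n
A ≈ B = ∃′ IsFunction 0F (suc A) (suc B) ∧ IsInjective 0F ∧ IsOnto 0F (suc B)
A ≼ B = ∃′ IsFunction 0F (suc A) (suc B) ∧ IsInjective 0F

-- i ∈ ω, where ω is the least inductive set
IsNatural : Fin n → Formula n
IsNatural i = ∀′ IsInductive 0F ⇒ suc i ∈ 0F

Finite Infinite : Fin n → Formula n
Finite   x = ∃′ IsNatural 0F ∧ suc x ≈ 0F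
Infinite x = ¬′ Finite x

-- x is the von Neumann numeral of the metatheoretic number m.
IsNumeral : ℕ → Fin n → Formula n
IsNumeral zero    x = IsEmpty x
IsNumeral (suc m) x = ∃′ IsNumeral m 0F ∧ IsSucc (suc x) 0F

-- |x| = m and |x| ≤ m
HasSize HasSize≤ : ℕ → Fin n → Formula n
HasSize  m x = ∃′ IsNumeral m 0F ∧ suc x ≈ 0F
HasSize≤ m x = ∃′ IsNumeral m 0F ∧ suc x ≼ 0F

-- Rainbow Ramsey and weak choice principles

-- z ∈ [X]ᵐ
_∈[_]^_ : (z X : Fin n) → ℕ → Formula n
z ∈[ X ]^ m = z ⊆ X ∧ HasSize m z

-- S = [X]ᵐ
_≐[_]^_ : (S X : Fin n) → ℕ → Formula n
S ≐[ X ]^ m = ∀′ (0F ∈ suc S ⇔ 0F ∈[ suc X ]^ m)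

-- |χ⁻¹[{c}]| ≤ b for each c ∈ C
Bounded : ℕ → (χ C : Fin n) → Formula n
Bounded b χ C =
  ∀∈[ C ] ∀′ (∀′ (0F ∈ 1F ⇔ Maps (3 ↑ʳ χ) 0F 2F)) ⇒ HasSize≤ b 0F

-- Distinct members s, t of [Z]ᵐ receive distinct colors c, d under χ.
Polychromatic : ℕ → (χ Z : Fin n) → Formula n
Polychromatic m χ Z =
  ∀′ ∀′ 1F ∈[ 2 ↑ʳ Z ]^ m ⇒ 0F ∈[ 2 ↑ʳ Z ]^ m ⇒ ¬′ (1F ≐ 0F) ⇒
    ∀′ ∀′ Maps (4 ↑ʳ χ) 3F 1F ⇒ Maps (4 ↑ʳ χ) 2F 0F ⇒ ¬′ (1F ≐ 0F)

-- The outer variables are X = 3F, C = 2F, S = [X]ᵐ = 1F and χ = 0F.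
RRT : (m b : ℕ) → Sentence
RRT m b =
  ∀′ ∀′ ∀′ ∀′ Infinite 3F ⇒ Infinite 2F ⇒ 1F ≐[ 3F ]^ m ⇒
    IsFunction 0F 1F 2F ⇒ Bounded b 0F 2F ⇒
    ∃′ 0F ⊆ 4F ∧ Infinite 0F ∧ Polychromatic m 1F 0F

-- B has a choice function: some f : B → U with f(b) ∈ b for all b ∈ B.
HasChoiceFunction : Fin n → Formula n
HasChoiceFunction B =
  ∃′ ∃′ IsFunction 0F (2 ↑ʳ B) 1F
    ∧ (∀∈[ 2 ↑ʳ B ] ∀′ Maps 2F 1F 0F ⇒ 0F ∈ 1F)

AC⁻ : ℕ → Sentence
AC⁻ m =
  ∀′ Infinite 0F ⇒ (∀∈[ 0F ] HasSize m 0F) ⇒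
    ∃′ 0F ⊆ 1F ∧ Infinite 0F ∧ HasChoiceFunction 0F

-- By completeness it suffices to argue in the structures that satisfy ZF, where
-- metatheoretic lists describe the sets of standard finite size.  Henkin's
-- construction is constructive for the fragment {⇒, ∀, ⊥} once ⊥ may be
-- interpreted by any type.
--
-- Given an infinite family A of n-element sets, made disjoint, let X be its
-- union and color s ∈ [X]ᵐ by its class for a relation with small classes.  An
-- infinite polychromatic Y meets infinitely many members of A.  For (1) the
-- class of s consists of s and of the set of partners of the points of s; two
-- points of Y in each of m members of A give two m-sets of the same color.  For
-- (2) and (3) the class of s consists of the m-sets meeting the same p + q
-- members of A as s, p of them in two points and q in one point, where
-- m = 2p + q; there are C(p + q, p) C(n, 2)ᵖ n^q of them, and two points of Y in
-- each of p + q members of A give two of these in Y.  So all but finitely many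
-- of the members of A that meet Y do so in a single point, which is chosen.  For
-- (4) take p = 1 and q = 0: then Y contains at most two points of each member of
-- A, hence Y or its complement selects a point of infinitely many of them.

module Submission where

open import Defs
open import Data.Empty using (⊥-elim)
open import Data.Fin using (Fin; zero; suc; lift; _↑ʳ_)
open import Data.Fin.Patterns
open import Data.List using (List; []; _∷_; _++_; map; length; allFin; cartesianProductWith)
open import Data.List.Membership.Propositional using () renaming (_∈_ to _∈ᴸ_)
open import Data.List.Membership.Propositional.Properties
  using (∈-map⁺; ∈-++⁺ˡ; ∈-++⁺ʳ; ∈-allFin; ∈-cartesianProductWith⁺)
open import Data.List.Properties using (map-∘; map-cong; length-map; length-++)
open import Data.List.Relation.Binary.Subset.Propositional using () renaming (_⊆_ to _⊆ᴸ_)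
open import Data.List.Relation.Binary.Subset.Propositional.Properties
  using () renaming (map⁺ to ⊆-map⁺; ∷⁺ʳ to ⊆-∷⁺ʳ; xs⊆ys++xs to ⊆-++ʳ; xs⊆xs++ys to ⊆-++ˡ)
open import Data.List.Relation.Unary.All using (All; []; _∷_; reduce)
open import Data.List.Relation.Unary.All.Properties using () renaming (++⁺ to All-++⁺)
open import Data.List.Relation.Unary.Any using (here; there)
open import Data.Nat using
  ( ℕ; zero; suc; _+_; _*_; _^_; _∸_; _≤_; _⊔_; z≤n; s≤s; _≤?_; _≤′_; ≤′-refl; ≤′-step; >-nonZero)
open import Data.Nat.Combinatorics using (_C_; nC1≡n; nCn≡1; nCk≡nC[n∸k]; nCk+nC[k+1]≡[n+1]C[k+1])
open import Data.Nat.Properties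
  using ( ≤-refl; ≤-reflexive; ≤-trans; ≤-antisym; m≤n⇒m≤1+n; m≤m⊔n; m≤n⊔m; m≤m+n; 1+n≰n; ≤⇒≤′; ≤′⇒≤
        ; suc-injective; +-suc; +-comm; +-assoc; +-identityʳ; *-identityˡ; +-cancelˡ-≡; +-cancelʳ-≡
        ; m+n∸m≡n; +-mono-≤; *-mono-≤; *-monoʳ-≤; m^n>0; module ≤-Reasoning)
open import Data.Nat.Tactic.RingSolver using (solve-∀)
open import Data.Product using (Σ; _×_; _,_; proj₁; proj₂)
open import Data.Sum using (_⊎_; inj₁; inj₂)
open import Data.Unit using (⊤; tt)
open import Data.Vec using (Vec; []; _∷_; lookup)
open import Data.Vec.Relation.Binary.Pointwise.Inductive as Pointwise using (Pointwise; []; _∷_)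
open import Function using (_∘_; id)
open import Relation.Binary.PropositionalEquality
  using (_≡_; refl; sym; trans; cong; cong₂; subst; subst₂)
open import Relation.Nullary using (yes; no)

-- In ZF a color class has to be definable from s, with nothing chosen inside the members of A. With
-- two-element members, passing from a point to its partner is definable; done at all points at once
-- it gives classes of size at most 2 for every m, so (1) asks only for a bound of at least 2. In
-- larger members no partner is distinguished, so the class takes in every set of the same pattern,
-- and r has to be at least their number.
--
-- The conflict in (2) and (3) comes from exchanging a point that is alone in its member, so q must
-- be at least 1. Since m = 2p + q, an odd m allows q = 1 with p = k, and an even m calls for q = 2
-- with p = k - 1: this is the origin of n (k + 1) and of n^2 C(k + 1, 2). In (4) no point is alone,
-- and the exchange would take a third point of Y in the same member.
--
-- Infinite means only not finite, so infinitude is obtained by contradiction: a set spread over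
-- finitely many listed fibres is finite, by an induction that lists one fibre at a time.

private variable
  k l n : ℕ

-- Renaming

lift-cong : {σ τ : Fin k → Fin n} → (∀ i → σ i ≡ τ i) → ∀ i → lift 1 σ i ≡ lift 1 τ i
lift-cong eq zero    = refl
lift-cong eq (suc i) = cong suc (eq i)

lift-∘ : (σ : Fin l → Fin n) (τ : Fin k → Fin l) →
  ∀ i → lift 1 σ (lift 1 τ i) ≡ lift 1 (σ ∘ τ) i
lift-∘ σ τ zero    = refl
lift-∘ σ τ (suc i) = refl

rename-cong : {σ τ : Fin k → Fin n} → (∀ i → σ i ≡ τ i) → ∀ φ → rename σ φ ≡ rename τ φ
rename-cong eq (x ∈ y) = cong₂ _∈_ (eq x) (eq y)
rename-cong eq (x ≐ y) = cong₂ _≐_ (eq x) (eq y)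
rename-cong eq ⊥′      = refl
rename-cong eq (φ ⇒ ψ) = cong₂ _⇒_ (rename-cong eq φ) (rename-cong eq ψ)
rename-cong eq (∀′ φ)  = cong ∀′_ (rename-cong (lift-cong eq) φ)

rename-∘ : (σ : Fin l → Fin n) (τ : Fin k → Fin l) →
  ∀ φ → rename σ (rename τ φ) ≡ rename (σ ∘ τ) φ
rename-∘ σ τ (x ∈ y) = refl
rename-∘ σ τ (x ≐ y) = refl
rename-∘ σ τ ⊥′      = refl
rename-∘ σ τ (φ ⇒ ψ) = cong₂ _⇒_ (rename-∘ σ τ φ) (rename-∘ σ τ ψ)
rename-∘ σ τ (∀′ φ)  = cong ∀′_
  (trans (rename-∘ (lift 1 σ) (lift 1 τ) φ) (rename-cong (lift-∘ σ τ) φ))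

rename-instantiate : (σ : Fin k → Fin n) (φ : Formula (suc k)) (x : Fin k) →
  rename σ (φ [ x ]) ≡ rename (lift 1 σ) φ [ σ x ]
rename-instantiate σ φ x = trans (rename-∘ σ (instantiate x) φ)
  (trans (rename-cong pointwise φ) (sym (rename-∘ (instantiate (σ x)) (lift 1 σ) φ)))
  where
  pointwise : ∀ i → σ (instantiate x i) ≡ instantiate (σ x) (lift 1 σ i)
  pointwise zero    = refl
  pointwise (suc i) = refl

-- Derivations

module _ {T : Theory} where

  ⊢-rename : {Γ : List (Formula k)} {φ : Formula k} (σ : Fin k → Fin n) →
    T ∣ Γ ⊢ φ → T ∣ map (rename σ) Γ ⊢ rename σ φ
  ⊢-rename σ (axiom {φ} t) =
    subst (T ∣ _ ⊢_) (sym (trans (rename-∘ σ _ φ) (rename-cong (λ ()) φ))) (axiom t)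
  ⊢-rename σ (assume i)      = assume (∈-map⁺ (rename σ) i)
  ⊢-rename σ (⇒-intro d)     = ⇒-intro (⊢-rename σ d)
  ⊢-rename σ (⇒-elim d e)    = ⇒-elim (⊢-rename σ d) (⊢-rename σ e)
  ⊢-rename σ (raa d)         = raa (⊢-rename σ d)
  ⊢-rename {Γ = Γ} σ (∀-intro {φ} d) = ∀-intro
    (subst (λ Δ → T ∣ Δ ⊢ rename (lift 1 σ) φ) swap (⊢-rename (lift 1 σ) d))
    where
    swap : map (rename (lift 1 σ)) (map weaken Γ) ≡ map weaken (map (rename σ) Γ)
    swap = trans (sym (map-∘ Γ)) (trans
      (map-cong (λ γ → trans (rename-∘ (lift 1 σ) suc γ) (sym (rename-∘ suc σ γ))) Γ)
      (map-∘ Γ))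
  ⊢-rename σ (∀-elim {φ} d x) =
    subst (T ∣ _ ⊢_) (sym (rename-instantiate σ φ x)) (∀-elim (⊢-rename σ d) (σ x))
  ⊢-rename σ (≐-refl x)      = ≐-refl (σ x)
  ⊢-rename σ (≐-subst φ {x} {y} d e) =
    subst (T ∣ _ ⊢_) (sym (rename-instantiate σ φ y))
      (≐-subst (rename (lift 1 σ) φ) (⊢-rename σ d)
        (subst (T ∣ _ ⊢_) (rename-instantiate σ φ x) (⊢-rename σ e)))

  ⊢-mono : {Γ Δ : List (Formula n)} {φ : Formula n} → Γ ⊆ᴸ Δ → T ∣ Γ ⊢ φ → T ∣ Δ ⊢ φ
  ⊢-mono s (axiom t)       = axiom t
  ⊢-mono s (assume i)      = assume (s i)
  ⊢-mono s (⇒-intro d)     = ⇒-intro (⊢-mono (⊆-∷⁺ʳ _ s) d)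
  ⊢-mono s (⇒-elim d e)    = ⇒-elim (⊢-mono s d) (⊢-mono s e)
  ⊢-mono s (raa d)         = raa (⊢-mono (⊆-∷⁺ʳ _ s) d)
  ⊢-mono s (∀-intro d)     = ∀-intro (⊢-mono (⊆-map⁺ weaken s) d)
  ⊢-mono s (∀-elim d x)    = ∀-elim (⊢-mono s d) x
  ⊢-mono s (≐-refl x)      = ≐-refl x
  ⊢-mono s (≐-subst φ d e) = ≐-subst φ (⊢-mono s d) (⊢-mono s e)

  ⊢-weaken : {Γ : List (Formula n)} {φ ψ : Formula n} → T ∣ Γ ⊢ φ → T ∣ ψ ∷ Γ ⊢ φ
  ⊢-weaken = ⊢-mono there

  ex-falso : {Γ : List (Formula n)} {φ : Formula n} → T ∣ Γ ⊢ ⊥′ → T ∣ Γ ⊢ φ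
  ex-falso d = raa (⊢-weaken d)

  cut : {Γ : List (Formula n)} {φ ψ : Formula n} → T ∣ Γ ⊢ φ → T ∣ φ ∷ Γ ⊢ ψ → T ∣ Γ ⊢ ψ
  cut d e = ⇒-elim (⇒-intro e) d

-- Structures

-- ⊥ is interpreted by an arbitrary type: the completeness proof below takes it
-- to be a type of derivations of ⊥, which makes it constructive.
record Structure : Set₁ where
  infix 4 _E_ _Q_
  field
    D   : Set
    _E_ : D → D → Set
    _Q_ : D → D → Set
    Bot : Set

  ⟦_⟧ : Formula n → Vec D n → Set
  ⟦ x ∈ y ⟧ ρ = lookup ρ x E lookup ρ y
  ⟦ x ≐ y ⟧ ρ = lookup ρ x Q lookup ρ y
  ⟦ ⊥′ ⟧    ρ = Bot
  ⟦ φ ⇒ ψ ⟧ ρ = ⟦ φ ⟧ ρ → ⟦ ψ ⟧ ρ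
  ⟦ ∀′ φ ⟧  ρ = ∀ x → ⟦ φ ⟧ (x ∷ ρ)

  -- Both directions are proved together because `_⇒_` is contravariant on the left. An equality of
  -- types would need function extensionality at `∀′_`.
  rename-⟦⟧ : (σ : Fin k → Fin n) {ρ : Vec D n} {ρ′ : Vec D k} →
    (∀ i → lookup ρ (σ i) ≡ lookup ρ′ i) → ∀ φ →
    (⟦ rename σ φ ⟧ ρ → ⟦ φ ⟧ ρ′) × (⟦ φ ⟧ ρ′ → ⟦ rename σ φ ⟧ ρ)
  rename-⟦⟧ σ eq (x ∈ y) = subst₂ _E_ (eq x) (eq y) , subst₂ _E_ (sym (eq x)) (sym (eq y))
  rename-⟦⟧ σ eq (x ≐ y) = subst₂ _Q_ (eq x) (eq y) , subst₂ _Q_ (sym (eq x)) (sym (eq y))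
  rename-⟦⟧ σ eq ⊥′ = id , id
  rename-⟦⟧ σ eq (φ ⇒ ψ) with rename-⟦⟧ σ eq φ | rename-⟦⟧ σ eq ψ
  ... | f , f⁻¹ | g , g⁻¹ = (λ h → g ∘ h ∘ f⁻¹) , (λ h → g⁻¹ ∘ h ∘ f)
  rename-⟦⟧ σ {ρ} {ρ′} eq (∀′ φ) =
    (λ h x → proj₁ (rename-⟦⟧ (lift 1 σ) (eq′ x) φ) (h x)) ,
    (λ h x → proj₂ (rename-⟦⟧ (lift 1 σ) (eq′ x) φ) (h x))
    where
    eq′ : ∀ x i → lookup (x ∷ ρ) (lift 1 σ i) ≡ lookup (x ∷ ρ′) i
    eq′ x zero    = refl
    eq′ x (suc i) = eq i

-- Soundness is demanded of a structure: for arbitrary `Bot` and `_Q_`, neither `raa` nor the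
-- equality rules need be valid.
Sound : Theory → Structure → Set
Sound T 𝔐 = ∀ {n} {Γ : List (Formula n)} {φ} → T ∣ Γ ⊢ φ →
  ∀ ρ → All (λ γ → ⟦ γ ⟧ ρ) Γ → ⟦ φ ⟧ ρ
  where open Structure 𝔐

-- Enumeration of formulas

-- Cantor's walk: each antidiagonal is run through from (s , 0) to (0 , s), then the next one
-- begins.
advance : ℕ × ℕ → ℕ × ℕ
advance (zero  , b) = suc b , zero
advance (suc a , b) = a , suc b

unpair : ℕ → ℕ × ℕ
unpair zero    = zero , zero
unpair (suc i) = advance (unpair i)

pair : ∀ a b → Σ ℕ λ i → unpair i ≡ (a , b)
pair a b = antidiagonal (a + b) a b refl
  where
  antidiagonal : ∀ s a b → a + b ≡ s → Σ ℕ λ i → unpair i ≡ (a , b)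
  antidiagonal zero zero zero refl = zero , refl
  antidiagonal s a (suc b) eq with antidiagonal s (suc a) b (trans (sym (+-suc a b)) eq)
  ... | i , eq′ = suc i , cong advance eq′
  antidiagonal (suc s) (suc a) zero refl with antidiagonal s zero a (+-comm zero a)
  ... | i , eq′ = suc i , cong advance eq′

proj₂-unpair≤ : ∀ i → proj₂ (unpair i) ≤ i
proj₂-unpair≤ zero = z≤n
proj₂-unpair≤ (suc i) with unpair i | proj₂-unpair≤ i
... | zero  , b | _  = z≤n
... | suc a , b | le = s≤s le

-- The default `⊥′` past the end is harmless, since `decode` only has to be onto.
nth : List (Formula n) → ℕ → Formula n
nth []       i       = ⊥′
nth (φ ∷ φs) zero    = φ
nth (φ ∷ φs) (suc i) = nth φs i

index : {φ : Formula n} {φs : List (Formula n)} → φ ∈ᴸ φs → Σ ℕ λ i → nth φs i ≡ φ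
index (here refl) = zero , refl
index (there p) with index p
... | i , eq = suc i , eq

-- Bounding the depth keeps the list finite, since only n variables are in scope. The recursion is
-- on the depth because n grows under a quantifier.
formulas : ℕ → ∀ n → List (Formula n)
formulas zero    n = []
formulas (suc d) n = ⊥′ ∷ cartesianProductWith _∈_ (allFin n) (allFin n)
  ++ cartesianProductWith _≐_ (allFin n) (allFin n)
  ++ cartesianProductWith _⇒_ (formulas d n) (formulas d n)
  ++ map ∀′_ (formulas d (suc n))

depth : Formula n → ℕ
depth (x ∈ y) = 1
depth (x ≐ y) = 1
depth ⊥′      = 1
depth (φ ⇒ ψ) = suc (depth φ ⊔ depth ψ)
depth (∀′ φ)  = suc (depth φ)

∈-formulas : ∀ (φ : Formula n) {d} → depth φ ≤ d → φ ∈ᴸ formulas d n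
∈-formulas {n} (x ∈ y) (s≤s _) = there (∈-++⁺ˡ
  (∈-cartesianProductWith⁺ _∈_ (∈-allFin x) (∈-allFin y)))
∈-formulas {n} (x ≐ y) (s≤s _) = there
  (∈-++⁺ʳ (cartesianProductWith _∈_ (allFin n) (allFin n))
  (∈-++⁺ˡ (∈-cartesianProductWith⁺ _≐_ (∈-allFin x) (∈-allFin y))))
∈-formulas ⊥′ (s≤s _) = here refl
∈-formulas {n} (φ ⇒ ψ) (s≤s le) = there
  (∈-++⁺ʳ (cartesianProductWith _∈_ (allFin n) (allFin n))
  (∈-++⁺ʳ (cartesianProductWith _≐_ (allFin n) (allFin n))
  (∈-++⁺ˡ (∈-cartesianProductWith⁺ _⇒_
    (∈-formulas φ (≤-trans (m≤m⊔n _ _) le)) (∈-formulas ψ (≤-trans (m≤n⊔m _ _) le))))))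
∈-formulas {n} (∀′ φ) {suc d} (s≤s le) = there
  (∈-++⁺ʳ (cartesianProductWith _∈_ (allFin n) (allFin n))
  (∈-++⁺ʳ (cartesianProductWith _≐_ (allFin n) (allFin n))
  (∈-++⁺ʳ (cartesianProductWith _⇒_ (formulas d n) (formulas d n))
  (∈-map⁺ ∀′_ (∈-formulas φ le)))))

decodeVec : ∀ n → ℕ → Vec ℕ n
decodeVec zero    i = []
decodeVec (suc n) i = proj₁ (unpair i) ∷ decodeVec n (proj₂ (unpair i))

encodeVec : (ρ : Vec ℕ n) → Σ ℕ λ i → decodeVec n i ≡ ρ
encodeVec [] = zero , refl
encodeVec {suc n} (x ∷ ρ) with encodeVec ρ
... | i , refl with pair x i
... | j , eq = j , cong₂ _∷_ (cong proj₁ eq) (cong (decodeVec n ∘ proj₂) eq)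

Instance : Set
Instance = Σ ℕ λ n → Formula n × Vec ℕ n

decode : ℕ → Instance
decode i =
  let (n , i₁) = unpair i
      (d , i₂) = unpair i₁
      (j , i₃) = unpair i₂
  in n , nth (formulas d n) j , decodeVec n (proj₁ (unpair i₃))

-- The last component of the code is padding, so that every instance is listed
-- arbitrarily late.
encode : (φ : Formula n) (ρ : Vec ℕ n) (b : ℕ) →
  Σ ℕ λ i → decode i ≡ (n , φ , ρ) × b ≤ i
encode {n} φ ρ b with index (∈-formulas φ ≤-refl) | encodeVec ρ
... | j , eqⱼ | v , eqᵥ with pair v b
... | i₃ , eq₃ with pair j i₃
... | i₂ , eq₂ with pair (depth φ) i₂
... | i₁ , eq₁ with pair n i₁
... | i , eq = i , decodes , ≤-trans (second≤ i₃ eq₃)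
      (≤-trans (second≤ i₂ eq₂) (≤-trans (second≤ i₁ eq₁) (second≤ i eq)))
  where
  decodes : decode i ≡ (n , φ , ρ)
  decodes rewrite eq | eq₁ | eq₂ | eq₃ = cong₂ (λ ψ τ → n , ψ , τ) eqⱼ eqᵥ
  second≤ : ∀ {a b} i → unpair i ≡ (a , b) → b ≤ i
  second≤ i refl = proj₂-unpair≤ i

-- Completeness

-- The individuals are natural numbers.  At stage N the individuals 0, …, N are
-- in scope; `var N x` is the de Bruijn index of x, with the most recent
-- individual N at index 0.  Individuals above N get a junk value.
var : ∀ N → ℕ → Fin (suc N)
var zero    x = zero
var (suc N) x with x ≤? N
... | yes _ = suc (var N x)
... | no  _ = zero

var-suc : ∀ N {x} → x ≤ N → var (suc N) x ≡ suc (var N x)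
var-suc N {x} le with x ≤? N
... | yes _ = refl
... | no  x≰N = ⊥-elim (x≰N le)

var-new : ∀ N → var (suc N) (suc N) ≡ zero
var-new N with suc N ≤? N
... | yes le = ⊥-elim (1+n≰n le)
... | no  _  = refl

at : ∀ N → Formula n → Vec ℕ n → Formula (suc N)
at N φ ρ = rename (λ i → var N (lookup ρ i)) φ

infix 4 _≼ⱽ_
_≼ⱽ_ : Vec ℕ n → ℕ → Set
ρ ≼ⱽ N = ∀ i → lookup ρ i ≤ N

bound : (ρ : Vec ℕ n) → Σ ℕ (ρ ≼ⱽ_)
bound []      = zero , λ ()
bound (x ∷ ρ) with bound ρ
... | N , le = x ⊔ N , λ { zero → m≤m⊔n x N ; (suc i) → ≤-trans (le i) (m≤n⊔m x N) }

at-suc : ∀ {N} (φ : Formula n) (ρ : Vec ℕ n) → ρ ≼ⱽ N → at (suc N) φ ρ ≡ weaken (at N φ ρ)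
at-suc {N = N} φ ρ le = trans (rename-cong (λ i → var-suc N (le i)) φ) (sym (rename-∘ suc _ φ))

at-new : ∀ {N} (φ : Formula (suc n)) (ρ : Vec ℕ n) → ρ ≼ⱽ N →
  at (suc N) φ (suc N ∷ ρ) ≡ rename (lift 1 (λ i → var N (lookup ρ i))) φ
at-new {N = N} φ ρ le = rename-cong pointwise φ
  where
  pointwise : ∀ i → var (suc N) (lookup (suc N ∷ ρ) i) ≡ lift 1 (λ i → var N (lookup ρ i)) i
  pointwise zero    = var-new N
  pointwise (suc i) = var-suc N (le i)

-- The newest individual becomes a counterexample to `∀′ φ` if there is one: the dual of the usual
-- witness axiom, as `∀′_` is the primitive quantifier. Other formulas get a tautology, so that
-- every stage adds exactly one such axiom.
henkin : Formula n → Formula (suc n)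
henkin (∀′ φ) = φ ⇒ weaken (∀′ φ)
henkin _      = ⊥′ ⇒ ⊥′

module Henkin (T : Theory) (φ₀ : Sentence) where

  Absurd : Set
  Absurd = T ∣ φ₀ ∷ [] ⊢ ⊥′

  infix 3 _⊩_
  _⊩_ : (Formula n → Set) → Formula n → Set
  Θ ⊩ φ = Σ (List _) λ Γ → All Θ Γ × (T ∣ Γ ⊢ φ)

  -- Consistency relative to φ₀: an inconsistency is not excluded but has to be turned into a
  -- refutation of φ₀.
  Consistent : (Formula n → Set) → Formula n → Set
  Consistent Θ φ = Σ (List _) (λ Γ → All Θ Γ × (T ∣ φ ∷ Γ ⊢ ⊥′)) → Absurd

  task : ∀ N → Formula (suc N)
  task N = let (_ , φ , ρ) = decode N in at N φ ρ

  -- A predicate rather than a list, since consistency of the task cannot be decided. Membership of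
  -- the task carries the evidence for its consistency instead.
  Stage : ∀ N → Formula (suc N) → Set
  Stage zero    χ = χ ≡ weaken φ₀
  Stage (suc N) χ = (Σ (Formula (suc N)) λ ψ → Stage N ψ × χ ≡ weaken ψ)
    ⊎ (Consistent (Stage N) (task N) × χ ≡ weaken (task N))
    ⊎ χ ≡ henkin (task N)

  strengthen-⊥ : {Γ : List (Formula (suc n))} → T ∣ map weaken Γ ⊢ ⊥′ → T ∣ Γ ⊢ ⊥′
  strengthen-⊥ d = ∀-elim (∀-intro {φ = ⊥′} d) zero

  -- Refuting φ ⇒ ∀φ proves φ of the fresh variable; generalizing gives ∀φ, hence the Henkin axiom
  -- itself, so the refutation already comes from Γ.
  unhenkin : (φ : Formula (suc n)) {Γ : List (Formula (suc n))} →
    T ∣ henkin φ ∷ map weaken Γ ⊢ ⊥′ → T ∣ Γ ⊢ ⊥′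
  unhenkin (∀′ φ) {Γ} d = strengthen-⊥ ⊥-from
    where
    instance-holds : T ∣ map weaken Γ ⊢ φ
    instance-holds = raa (⇒-elim (⇒-intro (⊢-mono (⊆-∷⁺ʳ _ there) d))
      (⇒-intro (ex-falso (⇒-elim (assume (there (here refl))) (assume (here refl))))))
    ⊥-from : T ∣ map weaken Γ ⊢ ⊥′
    ⊥-from = cut (⇒-intro (⊢-weaken (⊢-rename suc (∀-intro instance-holds)))) d
  unhenkin (x ∈ y) d = strengthen-⊥ (cut (⇒-intro (assume (here refl))) d)
  unhenkin (x ≐ y) d = strengthen-⊥ (cut (⇒-intro (assume (here refl))) d)
  unhenkin ⊥′      d = strengthen-⊥ (cut (⇒-intro (assume (here refl))) d)
  unhenkin (φ ⇒ ψ) d = strengthen-⊥ (cut (⇒-intro (assume (here refl))) d)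

  -- A derivation from stage N + 1 uses finitely many old formulas Γ, the
  -- Henkin axiom, and possibly the task, in which case the task is consistent.
  split : ∀ N {Δ} → All (Stage (suc N)) Δ →
    Σ (List (Formula (suc N))) λ Γ → All (Stage N) Γ ×
      (Δ ⊆ᴸ henkin (task N) ∷ map weaken Γ
       ⊎ Consistent (Stage N) (task N) × Δ ⊆ᴸ henkin (task N) ∷ map weaken (task N ∷ Γ))
  split N [] = [] , [] , inj₁ λ ()
  split N (s ∷ ss) with split N ss
  split N (inj₁ (ψ , p , refl) ∷ ss) | Γ , ps , inj₁ sub = ψ ∷ Γ , p ∷ ps , inj₁
    λ { (here refl) → there (here refl) ; (there i) → ⊆-∷⁺ʳ _ there (sub i) }
  split N (inj₁ (ψ , p , refl) ∷ ss) | Γ , ps , inj₂ (c , sub) = ψ ∷ Γ , p ∷ ps , inj₂ (c ,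
    λ { (here refl) → there (there (here refl)) ; (there i) → ⊆-∷⁺ʳ _ (⊆-∷⁺ʳ _ there) (sub i) })
  split N (inj₂ (inj₁ (c , refl)) ∷ ss) | Γ , ps , inj₁ sub = Γ , ps , inj₂ (c ,
    λ { (here refl) → there (here refl) ; (there i) → ⊆-∷⁺ʳ _ there (sub i) })
  split N (inj₂ (inj₁ (c , refl)) ∷ ss) | Γ , ps , inj₂ (_ , sub) = Γ , ps , inj₂ (c ,
    λ { (here refl) → there (here refl) ; (there i) → sub i })
  split N (inj₂ (inj₂ refl) ∷ ss) | Γ , ps , inj₁ sub = Γ , ps , inj₁
    λ { (here refl) → here refl ; (there i) → sub i }
  split N (inj₂ (inj₂ refl) ∷ ss) | Γ , ps , inj₂ (c , sub) = Γ , ps , inj₂ (c ,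
    λ { (here refl) → here refl ; (there i) → sub i })

  module Construction {ψ₀ : Formula 1} (inhabited : T ⊢ ∃′ ψ₀) where

    stage-consistent : ∀ N → Stage N ⊩ ⊥′ → Absurd
    -- Stage 0 has one individual in scope, φ₀ has none. The theorem `∃′ ψ₀` supplies an individual,
    -- so the extra variable can be discharged.
    stage-consistent zero (Γ , ps , d) = ⇒-elim (⊢-mono (λ ()) inhabited)
      (∀-intro (ex-falso (⊢-mono (all-φ₀ ps) d)))
      where
      all-φ₀ : ∀ {Γ} → All (Stage zero) Γ → Γ ⊆ᴸ weaken φ₀ ∷ []
      all-φ₀ (refl ∷ ps) (here refl) = here refl
      all-φ₀ (_ ∷ ps)    (there i)   = all-φ₀ ps i
    stage-consistent (suc N) (Δ , ss , d) with split N ss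
    ... | Γ , ps , inj₁ sub =
      stage-consistent N (Γ , ps , unhenkin (task N) (⊢-mono sub d))
    -- The consistency evidence stored with the task turns this refutation into `Absurd` directly.
    ... | Γ , ps , inj₂ (c , sub) = c (Γ , ps , unhenkin (task N) (⊢-mono sub d))

    ⊩-suc : ∀ {N φ} → Stage N ⊩ φ → Stage (suc N) ⊩ weaken φ
    ⊩-suc (Γ , ps , d) = map weaken Γ , weaken-all ps , ⊢-rename suc d
      where
      weaken-all : ∀ {N Γ} → All (Stage N) Γ → All (Stage (suc N)) (map weaken Γ)
      weaken-all []       = []
      weaken-all (p ∷ ps) = inj₁ (_ , p , refl) ∷ weaken-all ps

    record True (φ : Formula n) (ρ : Vec ℕ n) : Set where
      constructor holds
      field
        stage    : ℕ
        in-scope : ρ ≼ⱽ stage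
        forced   : Stage stage ⊩ at stage φ ρ

    delay : ∀ {N M} (φ : Formula n) (ρ : Vec ℕ n) → N ≤′ M → ρ ≼ⱽ N →
      Stage N ⊩ at N φ ρ → Stage M ⊩ at M φ ρ
    delay φ ρ ≤′-refl le t = t
    delay φ ρ (≤′-step {M} N≤M) le t =
      subst (Stage (suc M) ⊩_) (sym (at-suc φ ρ (λ i → ≤-trans (le i) (≤′⇒≤ N≤M))))
        (⊩-suc (delay φ ρ N≤M le t))

    True-mp : {φ ψ : Formula n} {ρ : Vec ℕ n} → True (φ ⇒ ψ) ρ → True φ ρ → True ψ ρ
    True-mp {φ = φ} {ψ} {ρ} (holds N le t) (holds M le′ u)
      with delay (φ ⇒ ψ) ρ (≤⇒≤′ (m≤m⊔n N M)) le t | delay φ ρ (≤⇒≤′ (m≤n⊔m N M)) le′ u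
    ... | Γ , ps , d | Δ , qs , e = holds (N ⊔ M) (λ i → ≤-trans (le i) (m≤m⊔n N M))
      (Γ ++ Δ , All-++⁺ ps qs , ⇒-elim (⊢-mono (⊆-++ˡ Γ Δ) d) (⊢-mono (⊆-++ʳ Δ Γ) e))

    True-⊢ : {φ : Formula n} (ρ : Vec ℕ n) → T ∣ [] ⊢ φ → True φ ρ
    True-⊢ ρ d with bound ρ
    ... | N , le = holds N le ([] , [] , ⊢-rename _ d)

    True-⊥ : {ρ : Vec ℕ n} → True ⊥′ ρ → Absurd
    True-⊥ (holds N _ t) = stage-consistent N t

    Absurd-True : Absurd → (φ : Formula n) (ρ : Vec ℕ n) → True φ ρ
    Absurd-True d φ ρ with bound ρ
    ... | N , le = holds N le (explode N)
      where
      explode : ∀ N {χ} → Stage N ⊩ χ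
      explode zero = weaken φ₀ ∷ [] , refl ∷ [] , ex-falso (⊢-rename suc d)
      explode (suc N) with ⊩-suc {φ = ⊥′} (explode N)
      ... | Γ , ps , e = Γ , ps , ex-falso e

    scheduled : (φ : Formula n) (ρ : Vec ℕ n) → Σ ℕ λ N → ρ ≼ⱽ N × task N ≡ at N φ ρ
    scheduled φ ρ with bound ρ
    ... | B , le with encode φ ρ B
    ... | N , eq , B≤N = N , (λ i → ≤-trans (le i) B≤N) ,
      cong (λ ι → at N (proj₁ (proj₂ ι)) (proj₂ (proj₂ ι))) eq

    -- Every instance is scheduled at some stage at which its parameters are in scope, and being
    -- consistent it is added there.
    True-max : (φ : Formula n) (ρ : Vec ℕ n) →
      (∀ N → ρ ≼ⱽ N → Consistent (Stage N) (at N φ ρ)) → True φ ρ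
    True-max φ ρ con with scheduled φ ρ
    ... | N , le , eq = holds (suc N) (λ i → m≤n⇒m≤1+n (le i)) (χ ∷ [] ,
      inj₂ (inj₁ (subst (Consistent (Stage N)) (sym eq) (con N le) ,
        trans (at-suc φ ρ le) (cong weaken (sym eq)))) ∷ [] ,
      assume (here refl))
      where
      χ = at (suc N) φ ρ

    -- A stage that refutes φ ⇒ ψ derives both φ and ¬ψ; then f yields ψ and with it `Absurd`. So
    -- the implication is consistent with every stage, without deciding whether φ is true.
    True-⇒ : {φ ψ : Formula n} {ρ : Vec ℕ n} → (True φ ρ → True ψ ρ) → True (φ ⇒ ψ) ρ
    True-⇒ {φ = φ} {ψ} {ρ} f = True-max (φ ⇒ ψ) ρ λ N le (Γ , ps , d) →
      let tφ : True φ ρ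
          tφ = holds N le (Γ , ps , raa (⇒-elim (⇒-intro (⊢-mono (⊆-∷⁺ʳ _ there) d))
            (⇒-intro (ex-falso (⇒-elim (assume (there (here refl))) (assume (here refl)))))))
          t¬ψ : True (¬′ ψ) ρ
          t¬ψ = holds N le (Γ , ps , ⇒-intro (⇒-elim (⇒-intro (⊢-mono (⊆-∷⁺ʳ _ there) d))
            (⇒-intro (assume (there (here refl))))))
      in True-⊥ {ρ = ρ} (True-mp {φ = ψ} {⊥′} t¬ψ (f tφ))

    True-∀-elim : {φ : Formula (suc n)} {ρ : Vec ℕ n} → True (∀′ φ) ρ → ∀ x → True φ (x ∷ ρ)
    True-∀-elim {φ = φ} {ρ} (holds N le t) x with delay (∀′ φ) ρ (≤⇒≤′ (m≤m⊔n N x)) le t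
    ... | Γ , ps , d = holds (N ⊔ x) le′ (Γ , ps ,
      subst (T ∣ Γ ⊢_) (trans (rename-∘ _ _ φ) (rename-cong pointwise φ)) (∀-elim d (var (N ⊔ x) x)))
      where
      le′ : (x ∷ ρ) ≼ⱽ (N ⊔ x)
      le′ zero    = m≤n⊔m N x
      le′ (suc i) = ≤-trans (le i) (m≤m⊔n N x)
      pointwise : ∀ i → instantiate (var (N ⊔ x) x) (lift 1 (λ i → var (N ⊔ x) (lookup ρ i)) i)
        ≡ var (N ⊔ x) (lookup (x ∷ ρ) i)
      pointwise zero    = refl
      pointwise (suc i) = refl

    True-henkin : (φ : Formula (suc n)) (ρ : Vec ℕ n) →
      Σ ℕ λ x → True (φ ⇒ weaken (∀′ φ)) (x ∷ ρ)
    True-henkin φ ρ with scheduled (∀′ φ) ρ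
    ... | N , le , eq =
      suc N , holds (suc N) le′ (_ ∷ [] , inj₂ (inj₂ eq′) ∷ [] , assume (here refl))
      where
      le′ : (suc N ∷ ρ) ≼ⱽ suc N
      le′ zero    = ≤-refl
      le′ (suc i) = m≤n⇒m≤1+n (le i)
      eq′ : at (suc N) (φ ⇒ weaken (∀′ φ)) (suc N ∷ ρ) ≡ henkin (task N)
      eq′ = trans (cong₂ _⇒_ (at-new φ ρ le)
              (trans (rename-∘ _ suc (∀′ φ)) (at-suc (∀′ φ) ρ le)))
            (cong henkin (sym eq))

    True-weaken : (φ : Formula n) {x : ℕ} {ρ : Vec ℕ n} → True (weaken φ) (x ∷ ρ) → True φ ρ
    True-weaken φ (holds N le t) = holds N (le ∘ suc) (subst (Stage N ⊩_) (rename-∘ _ suc φ) t)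

    True-∀-intro : {φ : Formula (suc n)} {ρ : Vec ℕ n} → (∀ x → True φ (x ∷ ρ)) → True (∀′ φ) ρ
    True-∀-intro {φ = φ} {ρ} f =
      let (x , t) = True-henkin φ ρ
      in True-weaken (∀′ φ) (True-mp t (f x))

    model : Structure
    model = record
      { D   = ℕ
      ; _E_ = λ x y → True (0F ∈ 1F) (x ∷ y ∷ [])
      ; _Q_ = λ x y → True (0F ≐ 1F) (x ∷ y ∷ [])
      ; Bot = Absurd
      }

    open Structure model using (⟦_⟧)

    -- The truth lemma. The two directions are mutually recursive because `_⇒_` exchanges them.
    to   : (φ : Formula n) {ρ : Vec ℕ n} → True φ ρ → ⟦ φ ⟧ ρ
    from : (φ : Formula n) {ρ : Vec ℕ n} → ⟦ φ ⟧ ρ → True φ ρ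
    to (x ∈ y) (holds N le t) = holds N (λ { 0F → le x ; 1F → le y }) t
    to (x ≐ y) (holds N le t) = holds N (λ { 0F → le x ; 1F → le y }) t
    to ⊥′ {ρ} t = True-⊥ {ρ = ρ} t
    to (φ ⇒ ψ) t = λ h → to ψ (True-mp {φ = φ} {ψ} t (from φ h))
    to (∀′ φ) t = λ x → to φ (True-∀-elim {φ = φ} t x)
    -- The stage is raised because `True` wants all of ρ in scope, not just the two individuals of
    -- the atom.
    from (x ∈ y) {ρ} (holds N le t) with bound ρ
    ... | B , le′ = holds (N ⊔ B) (λ i → ≤-trans (le′ i) (m≤n⊔m N B))
      (delay (0F ∈ 1F) (lookup ρ x ∷ lookup ρ y ∷ []) (≤⇒≤′ (m≤m⊔n N B)) le t)
    from (x ≐ y) {ρ} (holds N le t) with bound ρ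
    ... | B , le′ = holds (N ⊔ B) (λ i → ≤-trans (le′ i) (m≤n⊔m N B))
      (delay (0F ≐ 1F) (lookup ρ x ∷ lookup ρ y ∷ []) (≤⇒≤′ (m≤m⊔n N B)) le t)
    from ⊥′ {ρ} d = Absurd-True d ⊥′ ρ
    from (φ ⇒ ψ) f = True-⇒ {φ = φ} {ψ} λ t → from ψ (f (to φ t))
    from (∀′ φ) f = True-∀-intro {φ = φ} λ x → from φ (f x)

    -- No induction on derivations: the context is moved into the formula by `⇒-intro`, and a
    -- theorem of T is true at every environment.
    model-sound : Sound T model
    model-sound {Γ = Γ} {φ} d ρ ps = discharge Γ d ps
      where
      discharge : ∀ Γ {φ} → T ∣ Γ ⊢ φ → All (λ γ → ⟦ γ ⟧ ρ) Γ → ⟦ φ ⟧ ρ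
      discharge []      {φ} d []       = to φ (True-⊢ ρ d)
      discharge (γ ∷ Γ) d (p ∷ ps) = discharge Γ (⇒-intro d) ps p

    φ₀-holds : ⟦ φ₀ ⟧ []
    φ₀-holds = to φ₀ (holds zero (λ ()) (_ ∷ [] , rename-cong (λ ()) φ₀ ∷ [] , assume (here refl)))

-- In the model built from `¬′ φ`, `Bot` is the type of refutations of `¬′ φ`. So the truth of
-- `¬′ φ`, applied to the truth of φ, returns exactly the derivation that `raa` asks for.
completeness : {T : Theory} {ψ : Formula 1} → T ⊢ ∃′ ψ → (φ : Sentence) →
  (∀ 𝔐 → Sound T 𝔐 → Structure.⟦_⟧ 𝔐 φ []) → T ⊢ φ
completeness {T} inhabited φ valid = raa (φ₀-holds (valid model model-sound))
  where
  open Henkin T (¬′ φ)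
  open Construction inhabited

-- Counting the sets that meet given sets in one or two points

length-cartesianProductWith : {A B E : Set} (f : A → B → E) (xs : List A) (ys : List B) →
  length (cartesianProductWith f xs ys) ≡ length xs * length ys
length-cartesianProductWith f []       ys = refl
length-cartesianProductWith f (x ∷ xs) ys = trans (length-++ (map (f x) ys))
  (cong₂ _+_ (length-map (f x) ys) (length-cartesianProductWith f xs ys))

module _ {A : Set} where

  twoSubsets : List A → List (A × A)
  twoSubsets []       = []
  twoSubsets (x ∷ xs) = map (x ,_) xs ++ twoSubsets xs

  length-twoSubsets : ∀ xs → length (twoSubsets xs) ≡ length xs C 2
  length-twoSubsets []       = refl
  length-twoSubsets (x ∷ xs) = trans (length-++ (map (x ,_) xs)) (trans
    (cong₂ _+_ (trans (length-map (x ,_) xs) (sym (nC1≡n (length xs)))) (length-twoSubsets xs))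
    (nCk+nC[k+1]≡[n+1]C[k+1] (length xs) 1))

  addPair : A × A → List A → List A
  addPair (x , y) zs = x ∷ y ∷ zs

  -- Lists of two points from p members of a list of lists and one point from
  -- the q other members.
  selections : ℕ → ℕ → List (List A) → List (List A)
  selections zero    zero    []       = [] ∷ []
  selections zero    (suc q) []       = []
  selections (suc p) q       []       = []
  -- Every list must be met, so nothing qualifies when lists are left over.
  selections zero    zero    (F ∷ Fs) = []
  selections zero    (suc q) (F ∷ Fs) = cartesianProductWith _∷_ F (selections zero q Fs)
  selections (suc p) zero    (F ∷ Fs) = cartesianProductWith addPair (twoSubsets F) (selections p zero Fs)
  selections (suc p) (suc q) (F ∷ Fs) =
    cartesianProductWith addPair (twoSubsets F) (selections p (suc q) Fs)
    ++ cartesianProductWith _∷_ F (selections (suc p) q Fs)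

  single-∈ : ∀ p q {F Fs x zs} → x ∈ᴸ F → zs ∈ᴸ selections p q Fs →
    x ∷ zs ∈ᴸ selections p (suc q) (F ∷ Fs)
  single-∈ zero    q i j = ∈-cartesianProductWith⁺ _∷_ i j
  single-∈ (suc p) q {F} {Fs} i j =
    ∈-++⁺ʳ (cartesianProductWith addPair (twoSubsets F) (selections p (suc q) Fs)) (∈-cartesianProductWith⁺ _∷_ i j)

  double-∈ : ∀ p q {F Fs x y zs} → (x , y) ∈ᴸ twoSubsets F → zs ∈ᴸ selections p q Fs →
    x ∷ y ∷ zs ∈ᴸ selections (suc p) q (F ∷ Fs)
  double-∈ p zero    i j = ∈-cartesianProductWith⁺ addPair i j
  double-∈ p (suc q) i j = ∈-++⁺ˡ (∈-cartesianProductWith⁺ addPair i j)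

  -- Pascal's rule: the first list is met in two points, in C(n, 2) ways, or in one point, in n
  -- ways. It is an inequality because there are no selections unless Fs has p + q entries.
  length-selections : ∀ {n} p q {Fs} → All (λ F → length F ≡ n) Fs →
    length (selections p q Fs) ≤ ((p + q) C p) * (n C 2) ^ p * n ^ q
  length-selections zero    zero    []       = ≤-refl
  length-selections zero    (suc q) []       = z≤n
  length-selections (suc p) q       []       = z≤n
  length-selections zero    zero    (e ∷ es) = z≤n
  length-selections {n} zero (suc q) {F ∷ Fs} (refl ∷ es) = begin
    length (cartesianProductWith _∷_ F (selections zero q Fs))
      ≡⟨ length-cartesianProductWith _∷_ F (selections zero q Fs) ⟩
    n * length (selections zero q Fs) ≤⟨ *-monoʳ-≤ n (length-selections zero q es) ⟩
    n * (1 * n ^ q)                   ≡⟨ cong (n *_) (*-identityˡ (n ^ q)) ⟩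
    n * n ^ q                         ≡⟨ *-identityˡ (n ^ suc q) ⟨
    1 * (n * n ^ q)                   ∎
    where open ≤-Reasoning
  length-selections {n} (suc p) zero {F ∷ Fs} (refl ∷ es) = begin
    length (cartesianProductWith addPair (twoSubsets F) (selections p zero Fs))
      ≡⟨ length-cartesianProductWith addPair (twoSubsets F) (selections p zero Fs) ⟩
    length (twoSubsets F) * length (selections p zero Fs)
      ≤⟨ *-monoʳ-≤ (length (twoSubsets F)) (length-selections p zero es) ⟩
    length (twoSubsets F) * (((p + 0) C p) * c ^ p * 1)
      ≡⟨ cong₂ (λ a b → a * (b * c ^ p * 1)) (length-twoSubsets F) (one p) ⟩
    c * (1 * c ^ p * 1)               ≡⟨ rearrange c (c ^ p) ⟩
    1 * (c * c ^ p) * 1               ≡⟨ cong (λ b → b * (c * c ^ p) * 1) (one (suc p)) ⟨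
    ((suc p + 0) C suc p) * (c * c ^ p) * 1 ∎
    where
    open ≤-Reasoning
    c = n C 2
    one : ∀ p → (p + 0) C p ≡ 1
    one p = trans (cong (_C p) (+-identityʳ p)) (nCn≡1 p)
    rearrange : ∀ a b → a * (1 * b * 1) ≡ 1 * (a * b) * 1
    rearrange = solve-∀
  length-selections {n} (suc p) (suc q) {F ∷ Fs} (refl ∷ es) = begin
    length (cartesianProductWith addPair (twoSubsets F) (selections p (suc q) Fs)
      ++ cartesianProductWith _∷_ F (selections (suc p) q Fs))
      ≡⟨ length-++ (cartesianProductWith addPair (twoSubsets F) (selections p (suc q) Fs)) ⟩
    length (cartesianProductWith addPair (twoSubsets F) (selections p (suc q) Fs))
      + length (cartesianProductWith _∷_ F (selections (suc p) q Fs))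
      ≡⟨ cong₂ _+_ (trans (length-cartesianProductWith addPair (twoSubsets F) (selections p (suc q) Fs))
                     (cong (_* length (selections p (suc q) Fs)) (length-twoSubsets F)))
                   (length-cartesianProductWith _∷_ F (selections (suc p) q Fs)) ⟩
    c * length (selections p (suc q) Fs) + n * length (selections (suc p) q Fs)
      ≤⟨ +-mono-≤ (*-monoʳ-≤ c (length-selections p (suc q) es))
                  (*-monoʳ-≤ n (length-selections (suc p) q es)) ⟩
    c * (((p + suc q) C p) * c ^ p * (n * n ^ q)) + n * ((suc (p + q) C suc p) * (c * c ^ p) * n ^ q)
      ≡⟨ cong (λ a → c * ((a C p) * c ^ p * (n * n ^ q)) + n * ((suc (p + q) C suc p) * (c * c ^ p) * n ^ q))
           (+-suc p q) ⟩
    c * ((N C p) * c ^ p * (n * n ^ q)) + n * ((N C suc p) * (c * c ^ p) * n ^ q)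
      ≡⟨ rearrange c (N C p) (N C suc p) (c ^ p) n (n ^ q) ⟩
    (N C p + N C suc p) * (c * c ^ p) * (n * n ^ q)
      ≡⟨ cong (λ a → a * (c * c ^ p) * (n * n ^ q))
           (trans (nCk+nC[k+1]≡[n+1]C[k+1] N p) (cong (λ a → suc a C suc p) (sym (+-suc p q)))) ⟩
    ((suc p + suc q) C suc p) * (c * c ^ p) * (n * n ^ q) ∎
    where
    open ≤-Reasoning
    c = n C 2
    N = suc (p + q)
    rearrange : ∀ c a b d n e → c * (a * d * (n * e)) + n * (b * (c * d) * e) ≡ (a + b) * (c * d) * (n * e)
    rearrange = solve-∀

-- Classical reasoning in a model of ZF

module Model (𝔐 : Structure) (sound : Sound ZF 𝔐) where

  open Structure 𝔐

  infix 3 _↔_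

  private variable
    A B : Set

  -- Negation is relative to `Bot`, which may be inhabited. Hence `M` can be removed only from types
  -- known to be stable, above all from interpretations of formulas.
  Not M : Set → Set
  Not A = A → Bot
  M A = Not (Not A)

  -- Goals are brought to the form Bot, where classical facts may be unpacked.
  infixl 1 _>>=_
  _>>=_ : M A → (A → Bot) → Bot
  m >>= f = m f

  lem : (A : Set) → M (A ⊎ Not A)
  lem A k = k (inj₂ λ a → k (inj₁ a))

  _↔_ : Set → Set → Set
  A ↔ B = (A → B) × (B → A)

  -- The derivation of φ from ¬¬φ by `raa`, carried over to the structure by `sound`.
  stable : (φ : Formula n) (ρ : Vec D n) → M (⟦ φ ⟧ ρ) → ⟦ φ ⟧ ρ
  stable φ ρ m = sound {Γ = (¬′ ¬′ φ) ∷ []}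
    (raa (⇒-elim (assume (there (here refl))) (assume (here refl)))) ρ (m ∷ [])

  exf : (φ : Formula n) (ρ : Vec D n) → Bot → ⟦ φ ⟧ ρ
  exf φ ρ b = stable φ ρ λ _ → b

  ∧-intro : A → B → Not (A → Not B)
  ∧-intro a b k = k a b

  ∧-elim : Not (A → Not B) → M (A × B)
  ∧-elim h k = h λ a b → k (a , b)

  ∃-elim : {P : D → Set} → Not (∀ x → Not (P x)) → M (Σ D P)
  ∃-elim h k = h λ x p → k (x , p)

  ∃-intro : {P : D → Set} (x : D) → P x → Not (∀ x → Not (P x))
  ∃-intro x p k = k x p

  ∃-∧-intro : {P R : D → Set} (x : D) → P x → R x → Not (∀ x → Not (Not (P x → Not (R x))))
  ∃-∧-intro x p r k = k x λ h → h p r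

  ∃-∧-elim : {P R : D → Set} → Not (∀ x → Not (Not (P x → Not (R x)))) → M (Σ D λ x → P x × R x)
  ∃-∧-elim h k = h λ x pr → pr λ p r → k (x , p , r)

  ∨-elim : (Not A → B) → M (A ⊎ B)
  ∨-elim f k = k (inj₂ (f λ a → k (inj₁ a)))

  ⇔-elim : (φ ψ : Formula n) (ρ : Vec D n) → ⟦ φ ⇔ ψ ⟧ ρ → ⟦ φ ⟧ ρ ↔ ⟦ ψ ⟧ ρ
  ⇔-elim φ ψ ρ h = (λ p → stable ψ ρ λ k → h λ f _ → k (f p)) ,
                   (λ q → stable φ ρ λ k → h λ _ g → k (g q))

  E-stable : ∀ {x y} → M (x E y) → x E y
  E-stable {x} {y} = stable (0F ∈ 1F) (x ∷ y ∷ [])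

  Q-stable : ∀ {x y} → M (x Q y) → x Q y
  Q-stable {x} {y} = stable (0F ≐ 1F) (x ∷ y ∷ [])

  E-exf : ∀ {x y} → Bot → x E y
  E-exf b = E-stable λ _ → b

  Q-exf : ∀ {x y} → Bot → x Q y
  Q-exf b = Q-stable λ _ → b

  Q-refl : ∀ {x} → x Q x
  Q-refl {x} = sound {Γ = []} (≐-refl 0F) (x ∷ []) []

  Q-sym : ∀ {x y} → x Q y → y Q x
  Q-sym {x} {y} p = sound {Γ = 0F ≐ 1F ∷ []}
    (≐-subst (0F ≐ 1F) {0F} {1F} (assume (here refl)) (≐-refl 0F)) (x ∷ y ∷ []) (p ∷ [])

  Q-trans : ∀ {x y z} → x Q y → y Q z → x Q z
  Q-trans {x} {y} {z} p q = sound {Γ = 1F ≐ 2F ∷ 0F ≐ 1F ∷ []}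
    (≐-subst (1F ≐ 0F) {1F} {2F} (assume (here refl)) (assume (there (here refl))))
    (x ∷ y ∷ z ∷ []) (q ∷ p ∷ [])

  E-respˡ : ∀ {x y z} → x Q y → x E z → y E z
  E-respˡ {x} {y} {z} p q = sound {Γ = 0F ≐ 1F ∷ 0F ∈ 2F ∷ []}
    (≐-subst (0F ∈ 3F) {0F} {1F} (assume (here refl)) (assume (there (here refl))))
    (x ∷ y ∷ z ∷ []) (p ∷ q ∷ [])

  E-respʳ : ∀ {x y z} → y Q z → x E y → x E z
  E-respʳ {x} {y} {z} p q = sound {Γ = 1F ≐ 2F ∷ 0F ∈ 1F ∷ []}
    (≐-subst (1F ∈ 0F) {1F} {2F} (assume (here refl)) (assume (there (here refl))))
    (x ∷ y ∷ z ∷ []) (p ∷ q ∷ [])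

  infix 4 _Q*_
  _Q*_ : Vec D n → Vec D n → Set
  _Q*_ = Pointwise _Q_

  Q*-refl : {ρ : Vec D n} → ρ Q* ρ
  Q*-refl = Pointwise.refl Q-refl

  Q*-sym : {ρ ρ′ : Vec D n} → ρ Q* ρ′ → ρ′ Q* ρ
  Q*-sym = Pointwise.sym Q-sym

  resp : (φ : Formula n) {ρ ρ′ : Vec D n} → ρ Q* ρ′ → ⟦ φ ⟧ ρ → ⟦ φ ⟧ ρ′
  resp (x ∈ y) eq h = E-respˡ (Pointwise.lookup eq x) (E-respʳ (Pointwise.lookup eq y) h)
  resp (x ≐ y) eq h = Q-trans (Q-sym (Pointwise.lookup eq x)) (Q-trans h (Pointwise.lookup eq y))
  resp ⊥′      eq h = h
  resp (φ ⇒ ψ) eq h p = resp ψ eq (h (resp φ (Q*-sym eq) p))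
  resp (∀′ φ)  eq h x = resp φ (Q-refl ∷ eq) (h x)

  zf : ∀ {φ} → ZF φ → ⟦ φ ⟧ []
  zf {φ} t = proj₁ (rename-⟦⟧ (λ ()) (λ ()) φ) (sound (axiom t) [] [])

  closure-elim : ∀ n {φ} → ⟦ closure n φ ⟧ [] → (ρ : Vec D n) → ⟦ φ ⟧ ρ
  closure-elim zero    h []      = h
  closure-elim (suc n) h (x ∷ ρ) = closure-elim n h ρ x

  -- Basic constructions

  ext : ∀ {x y} → (∀ z → z E x ↔ z E y) → x Q y
  ext {x} {y} h = zf extensionality y x λ z → ∧-intro (proj₁ (h z)) (proj₂ (h z))

  sep : (φ : Formula (1 + n)) (ρ : Vec D n) (a : D) →
    M (Σ D λ b → ∀ x → x E b ↔ (x E a × ⟦ φ ⟧ (x ∷ ρ)))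
  sep {n} φ ρ a k = closure-elim n (zf (separation n φ)) ρ a λ b h → k (b , λ x →
    let φ′ = rename (lift 1 (2 ↑ʳ_)) φ
        τ  = x ∷ b ∷ a ∷ ρ
        f , g = ⇔-elim (0F ∈ 1F) (0F ∈ 2F ∧ φ′) τ (h x)
        to , from = rename-⟦⟧ (lift 1 (2 ↑ʳ_)) {τ} {x ∷ ρ} (λ { zero → refl ; (suc i) → refl }) φ
    in (λ p → E-stable (λ k → f p λ q _ → k q) ,
          to (stable φ′ τ λ k → f p λ _ q → k q)) ,
       (λ (p , q) → g (∧-intro p (from q))))

  pairing-set : ∀ x y → M (Σ D λ z → ∀ u → u E z ↔ (Not (u Q x) → u Q y))
  pairing-set x y k = zf pairing y x λ z h → k (z , λ u →
    ⇔-elim (0F ∈ 1F) (0F ≐ 2F ∨ 0F ≐ 3F) (u ∷ z ∷ x ∷ y ∷ []) (h u))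

  union-set : ∀ x → M (Σ D λ z → ∀ u → u E z ↔ M (Σ D λ v → v E x × u E v))
  union-set x k = zf union x λ z h → k (z , λ u →
    let f , g = ⇔-elim (0F ∈ 1F) (∃∈[ 2F ] 1F ∈ 0F) (u ∷ z ∷ x ∷ []) (h u)
    in (λ p → ∃-∧-elim (f p)) , (λ m → g λ k → m λ (v , p , q) → ∃-∧-intro v p q k))

  power-set : ∀ x → M (Σ D λ z → ∀ u → u E z ↔ (∀ v → v E u → v E x))
  power-set x k = zf powerset x λ z h → k (z , λ u →
    ⇔-elim (0F ∈ 1F) (0F ⊆ 2F) (u ∷ z ∷ x ∷ []) (h u))

  binary-union : ∀ x y → M (Σ D λ z → ∀ u → u E z ↔ (Not (u E x) → u E y))
  binary-union x y k = do
    p , hp ← pairing-set x y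
    z , hz ← union-set p
    k (z , λ u →
      (λ q nx → E-stable λ k → do
        v , v∈p , u∈v ← proj₁ (hz u) q
        k (E-respʳ (proj₁ (hp v) v∈p λ v≐x → nx (E-respʳ v≐x u∈v)) u∈v)) ,
      (λ f → proj₂ (hz u) λ k → lem (u E x) λ
        { (inj₁ u∈x) → k (x , proj₂ (hp x) (λ n → Q-exf (n Q-refl)) , u∈x)
        ; (inj₂ u∉x) → k (y , proj₂ (hp y) (λ _ → Q-refl) , f u∉x) }))

  -- Finite lists of individuals

  infix 4 _∈ₗ_ _∉ₗ_
  -- A classical disjunction of equations, written as nested implications that end in `Bot`.
  -- Applying a membership proof to inequalities rules out the leading entries one by one.
  _∈ₗ_ _∉ₗ_ : D → List D → Set
  z ∈ₗ []    = Bot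
  z ∈ₗ y ∷ L = Not (z Q y) → z ∈ₗ L
  z ∉ₗ L     = Not (z ∈ₗ L)

  ∈ₗ-exf : ∀ {z} L → Bot → z ∈ₗ L
  ∈ₗ-exf []      b   = b
  ∈ₗ-exf (y ∷ L) b _ = ∈ₗ-exf L b

  ∈ₗ-stable : ∀ {z} L → M (z ∈ₗ L) → z ∈ₗ L
  ∈ₗ-stable []      m   = m λ b → b
  ∈ₗ-stable (y ∷ L) m n = ∈ₗ-stable L λ k → m λ h → k (h n)

  ∈ₗ-here : ∀ {z y} L → z Q y → z ∈ₗ y ∷ L
  ∈ₗ-here L p n = ∈ₗ-exf L (n p)

  ∈ₗ-resp : ∀ {z z′} L → z Q z′ → z ∈ₗ L → z′ ∈ₗ L
  ∈ₗ-resp []      eq h   = h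
  ∈ₗ-resp (y ∷ L) eq h n = ∈ₗ-resp L eq (h λ p → n (Q-trans (Q-sym eq) p))

  Distinct : List D → Set
  Distinct []      = ⊤
  Distinct (y ∷ L) = y ∉ₗ L × Distinct L

  infix 4 _lists_
  _lists_ : List D → D → Set
  L lists x = ∀ z → z E x ↔ z ∈ₗ L

  list-set : ∀ L → M (Σ D (L lists_))
  list-set [] k = zf infinity λ x _ → sep ⊥′ [] x λ (b , h) →
    k (b , λ z → (λ p → proj₂ (proj₁ (h z) p)) , E-exf)
  list-set (y ∷ L) k = do
    x , h ← list-set L
    p , hp ← pairing-set y y
    b , hb ← binary-union p x
    k (b , λ z →
      (λ z∈b n → proj₁ (h z) (proj₁ (hb z) z∈b λ z∈p → n (proj₁ (hp z) z∈p n))) ,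
      (λ f → proj₂ (hb z) λ n → proj₂ (h z) (f λ p → n (proj₂ (hp z) λ _ → p))))

  remove : ∀ y L → y ∈ₗ L → M (Σ (List D) λ L′ →
    length L ≡ suc (length L′) × (∀ z → Not (z Q y) → z ∈ₗ L → z ∈ₗ L′))
  remove y []      h k = h
  remove y (x ∷ L) h k = lem (y Q x) λ
    { (inj₁ p) → k (L , refl , λ z n q → q λ r → n (Q-trans r (Q-sym p)))
    ; (inj₂ n) → remove y L (h n) λ (L′ , eq , f) →
        k (x ∷ L′ , cong suc eq , λ z nz q nx → f z nz (q nx)) }

  pigeonhole : ∀ L L′ → Distinct L → (∀ z → z ∈ₗ L → z ∈ₗ L′) → M (length L ≤ length L′)
  pigeonhole []      L′ d sub k = k z≤n
  pigeonhole (y ∷ L) L′ (y∉ , d) sub k = do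
    L″ , eq , f ← remove y L′ (sub y (∈ₗ-here L Q-refl))
    le ← pigeonhole L L″ d λ z z∈ → f z (λ p → y∉ (∈ₗ-resp L p z∈)) (sub z λ _ → z∈)
    k (subst (suc (length L) ≤_) (sym eq) (s≤s le))

  -- Ordered pairs and functions

  opair : D → D → D → Set
  opair p x y = ⟦ IsOrderedPair 0F 1F 2F ⟧ (p ∷ x ∷ y ∷ [])

  opair-intro : ∀ {p x y u v} → ⟦ IsPair 0F 1F 1F ⟧ (u ∷ x ∷ []) → ⟦ IsPair 0F 1F 2F ⟧ (v ∷ x ∷ y ∷ []) →
    ⟦ IsPair 0F 1F 2F ⟧ (p ∷ u ∷ v ∷ []) → opair p x y
  opair-intro {u = u} {v} hu hv hp k = k u λ k → k v (∧-intro hu (∧-intro hv hp))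

  isPair-elim : ∀ {z x y} → ⟦ IsPair 0F 1F 2F ⟧ (z ∷ x ∷ y ∷ []) → ∀ u → u E z ↔ (Not (u Q x) → u Q y)
  isPair-elim {z} {x} {y} h u = ⇔-elim (0F ∈ 1F) (0F ≐ 2F ∨ 0F ≐ 3F) (u ∷ z ∷ x ∷ y ∷ []) (h u)

  opair-exists : ∀ x y → M (Σ D λ p → opair p x y)
  opair-exists x y k = do
    u , hu ← pairing-set x x
    v , hv ← pairing-set x y
    p , hp ← pairing-set u v
    k (p , opair-intro (λ z → ∧-intro (proj₁ (hu z)) (proj₂ (hu z)))
      (λ z → ∧-intro (proj₁ (hv z)) (proj₂ (hv z)))
      (λ z → ∧-intro (proj₁ (hp z)) (proj₂ (hp z))))

  opair-elim : ∀ {p x y} → opair p x y → M (Σ D λ u → Σ D λ v →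
    (∀ z → z E u ↔ (Not (z Q x) → z Q x)) × (∀ z → z E v ↔ (Not (z Q x) → z Q y)) ×
    (∀ z → z E p ↔ (Not (z Q u) → z Q v)))
  opair-elim h k = h λ u h′ → h′ λ v hs → ∧-elim hs λ (hu , hs′) → ∧-elim hs′ λ (hv , hp) →
    k (u , v , isPair-elim hu , isPair-elim hv , isPair-elim hp)

  opair-inj : ∀ {p x y x′ y′} → opair p x y → opair p x′ y′ → x Q x′ × y Q y′
  opair-inj {p} {x} {y} {x′} {y′} h h′ = first , Q-stable second
    where
    -- These facts about p determine x and then y, and they are uniform in whether x and y coincide.
    Facts : D → D → Set
    Facts x y = (∀ w → w E p → x E w) × Σ D (λ w → w E p × ∀ z → z E w → z Q x) ×
      Σ D (λ w → w E p × y E w) × (∀ w → w E p → ∀ z → z E w → Not (z Q x) → z Q y)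
    facts : ∀ {x y} → opair p x y → M (Facts x y)
    facts {x} {y} h k = do
      u , v , hu , hv , hp ← opair-elim h
      let x∈u = proj₂ (hu x) (λ _ → Q-refl)
          x∈v = proj₂ (hv x) (λ n → Q-exf (n Q-refl))
          u∈p = proj₂ (hp u) (λ n → Q-exf (n Q-refl))
          v∈p = proj₂ (hp v) (λ _ → Q-refl)
          single : ∀ z → z E u → z Q x
          single z q = Q-stable λ k → k (proj₁ (hu z) q k)
      k ((λ w w∈p → E-stable λ k → lem (w Q u) λ
            { (inj₁ q) → k (E-respʳ (Q-sym q) x∈u)
            ; (inj₂ n) → k (E-respʳ (Q-sym (proj₁ (hp w) w∈p n)) x∈v) }) ,
         (u , u∈p , single) ,
         (v , v∈p , proj₂ (hv y) (λ _ → Q-refl)) ,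
         λ w w∈p z z∈w n → Q-stable λ k → lem (w Q u) λ
            { (inj₁ q) → n (single z (E-respʳ q z∈w))
            ; (inj₂ m) → k (proj₁ (hv z) (E-respʳ (proj₁ (hp w) w∈p m) z∈w) n) })
    first : x Q x′
    first = Q-stable λ k → do
      f , (w , w∈p , s) , _ ← facts h
      f′ , _ ← facts h′
      k (Q-sym (s x′ (f′ w w∈p)))
    second : M (y Q y′)
    second k = do
      _ , _ , (v , v∈p , y∈v) , c ← facts h
      _ , _ , (v′ , v′∈p , y′∈v′) , c′ ← facts h′
      let n₁ : Not (y Q x′)
          n₁ q = k (Q-sym (c v′ v′∈p y′ y′∈v′ λ r → k
            (Q-trans q (Q-trans (Q-sym first) (Q-sym r)))))
      k (c′ v v∈p y y∈v n₁)

  maps : D → D → D → Set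
  maps f x y = ⟦ Maps 0F 1F 2F ⟧ (f ∷ x ∷ y ∷ [])

  maps-intro : ∀ {f p x y} → p E f → opair p x y → maps f x y
  maps-intro {p = p} h o k = k p (∧-intro h o)

  maps-elim : ∀ {f x y} → maps f x y → M (Σ D λ p → p E f × opair p x y)
  maps-elim h = ∃-∧-elim h

  opair-unique : ∀ {p p′ x y} → opair p x y → opair p′ x y → p Q p′
  opair-unique h h′ = Q-stable λ k → do
    u , v , hu , hv , hp ← opair-elim h
    u′ , v′ , hu′ , hv′ , hp′ ← opair-elim h′
    let u≐ = ext λ z → (proj₂ (hu′ z) ∘ proj₁ (hu z)) , (proj₂ (hu z) ∘ proj₁ (hu′ z))
        v≐ = ext λ z → (proj₂ (hv′ z) ∘ proj₁ (hv z)) , (proj₂ (hv z) ∘ proj₁ (hv′ z))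
    k (ext λ z →
      (λ q → proj₂ (hp′ z) λ n → Q-trans (proj₁ (hp z) q λ r → n (Q-trans r u≐)) v≐) ,
      (λ q → proj₂ (hp z) λ n → Q-trans (proj₁ (hp′ z) q λ r → n (Q-trans r (Q-sym u≐))) (Q-sym v≐)))

  opair-resp : ∀ {p p′ x x′ y y′} → p Q p′ → x Q x′ → y Q y′ → opair p x y → opair p′ x′ y′
  opair-resp a b c = resp (IsOrderedPair 0F 1F 2F) (a ∷ b ∷ c ∷ [])

  maps-resp : ∀ {f x x′ y y′} → x Q x′ → y Q y′ → maps f x y → maps f x′ y′
  maps-resp b c = resp (Maps 0F 1F 2F) (Q-refl ∷ b ∷ c ∷ [])

  record Graph (f A B : D) (R : D → D → Set) : Set where
    field
      pairs : ∀ p → p E f → M (Σ D λ x → Σ D λ y → x E A × y E B × opair p x y)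
      sound-graph : ∀ {x y} → maps f x y → x E A × y E B × R x y
      complete-graph : ∀ {x y} → x E A → y E B → R x y → maps f x y

  graph : (φ : Formula (2 + n)) (ρ : Vec D n) (A B : D) →
    M (Σ D λ f → Graph f A B λ x y → ⟦ φ ⟧ (y ∷ x ∷ ρ))
  graph {n} φ ρ A B k = do
    W , hW ← binary-union A B
    P , hP ← power-set W
    P₂ , hP₂ ← power-set P
    f , hf ← sep ψ (A ∷ B ∷ ρ) P₂
    let elim : ∀ {p} → p E f → M (Σ D λ x → Σ D λ y → x E A × y E B × opair p x y × ⟦ φ ⟧ (y ∷ x ∷ ρ))
        elim {p} p∈f k = proj₂ (proj₁ (hf p) p∈f) λ x h → h λ y h′ →
          ∧-elim h′ λ (x∈A , h″) → ∧-elim h″ λ (y∈B , h‴) → ∧-elim h‴ λ (o , r) →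
          k (x , y , x∈A , y∈B , o , proj₁ (shift p x y) r)
        fact : ∀ {x y} → maps f x y → M (x E A × y E B × ⟦ φ ⟧ (y ∷ x ∷ ρ))
        fact {x} {y} h k = do
          p , p∈f , o ← maps-elim h
          x′ , y′ , x′∈A , y′∈B , o′ , r ← elim p∈f
          let ex , ey = opair-inj o′ o
          k (E-respˡ ex x′∈A , E-respˡ ey y′∈B , resp φ (ey ∷ ex ∷ Q*-refl) r)
    k (f , record
      { pairs = λ p p∈f k → elim p∈f λ (x , y , a , b , o , _) → k (x , y , a , b , o)
      ; sound-graph = λ {x} {y} h → E-stable (λ k → fact h λ (a , _) → k a) ,
          E-stable (λ k → fact h λ (_ , b , _) → k b) ,
          stable φ (y ∷ x ∷ ρ) (λ k → fact h λ (_ , _ , r) → k r)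
      ; complete-graph = λ {x} {y} x∈A y∈B r → stable (Maps 0F 1F 2F) (f ∷ x ∷ y ∷ []) λ k → do
          p , o ← opair-exists x y
          u , v , hu , hv , hp ← opair-elim o
          let x∈W = proj₂ (hW x) (λ n → E-exf (n x∈A))
              y∈W = proj₂ (hW y) (λ _ → y∈B)
              in-P : ∀ w → w E p → w E P
              in-P w w∈p = proj₂ (hP w) λ z z∈w → E-stable λ k → lem (w Q u) λ
                { (inj₁ q) → k (E-respˡ (Q-sym (Q-stable λ k → k (proj₁ (hu z) (E-respʳ q z∈w) k))) x∈W)
                ; (inj₂ m) → lem (z Q x) λ
                  { (inj₁ q) → k (E-respˡ (Q-sym q) x∈W)
                  ; (inj₂ nx) → k (E-respˡ (Q-sym (proj₁ (hv z) (E-respʳ (proj₁ (hp w) w∈p m) z∈w) nx)) y∈W) } }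
          k (maps-intro (proj₂ (hf p) (proj₂ (hP₂ p) in-P , λ k → k x λ k → k y
            (∧-intro x∈A (∧-intro y∈B (∧-intro o (proj₂ (shift p x y) r)))))) o)
      })
    where
    ψ : Formula (3 + n)
    ψ = ∃′ ∃′ 1F ∈ 3F ∧ 0F ∈ 4F ∧ IsOrderedPair 2F 1F 0F ∧ rename (lift 2 (3 ↑ʳ_)) φ
    shift : ∀ p x y → ⟦ rename (lift 2 (3 ↑ʳ_)) φ ⟧ (y ∷ x ∷ p ∷ A ∷ B ∷ ρ) ↔ ⟦ φ ⟧ (y ∷ x ∷ ρ)
    shift p x y = rename-⟦⟧ (lift 2 (3 ↑ʳ_)) (λ { 0F → refl ; 1F → refl ; (suc (suc i)) → refl }) φ

  record IsFun (f A B : D) : Set where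
    field
      pairs      : ∀ p → p E f → M (Σ D λ x → Σ D λ y → x E A × y E B × opair p x y)
      maps-∈     : ∀ {x y} → maps f x y → x E A × y E B
      total      : ∀ {x} → x E A → M (Σ D (maps f x))
      functional : ∀ {x y y′} → maps f x y → maps f x y′ → y Q y′

  fun-intro : ∀ {f A B} → IsFun f A B → ⟦ IsFunction 0F 1F 2F ⟧ (f ∷ A ∷ B ∷ [])
  fun-intro F = ∧-intro
    (λ p p∈f k → pairs p p∈f λ (x , y , x∈A , y∈B , o) → k x (∧-intro x∈A (∃-∧-intro y y∈B o)))
    (λ x x∈A k → total x∈A λ (y , h) → k y (∧-intro h λ z hz → functional hz h))
    where open IsFun F

  fun-elim : ∀ {f A B} → ⟦ IsFunction 0F 1F 2F ⟧ (f ∷ A ∷ B ∷ []) → M (IsFun f A B)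
  fun-elim {f} {A} {B} h k = do
    h₁ , h₂ ← ∧-elim h
    let pairs : ∀ p → p E f → M (Σ D λ x → Σ D λ y → x E A × y E B × opair p x y)
        pairs p p∈f k = do
          x , x∈A , hx ← ∃-∧-elim (h₁ p p∈f)
          y , y∈B , o ← ∃-∧-elim hx
          k (x , y , x∈A , y∈B , o)
        maps-∈ : ∀ {x y} → maps f x y → M (x E A × y E B)
        maps-∈ h k = do
          p , p∈f , o ← maps-elim h
          x′ , y′ , x∈A , y∈B , o′ ← pairs p p∈f
          let ex , ey = opair-inj o′ o
          k (E-respˡ ex x∈A , E-respˡ ey y∈B)
    k record
      { pairs = pairs
      ; maps-∈ = λ h → E-stable (λ k → maps-∈ h λ (a , _) → k a) , E-stable (λ k → maps-∈ h λ (_ , b) → k b)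
      ; total = λ {x} x∈A k → ∃-∧-elim (h₂ x x∈A) λ (y , m , _) → k (y , m)
      ; functional = λ {x} {y} {y′} m m′ → Q-stable λ k → do
          x∈A , _ ← maps-∈ m
          z , _ , u ← ∃-∧-elim (h₂ x x∈A)
          k (Q-trans (u y m) (Q-sym (u y′ m′)))
      }

  graph-fun : ∀ {f A B} {R : D → D → Set} → Graph f A B R →
    (∀ {x} → x E A → M (Σ D λ y → y E B × R x y)) →
    (∀ {x y y′} → x E A → R x y → R x y′ → y Q y′) → IsFun f A B
  graph-fun G t u = record
    { pairs = pairs
    ; maps-∈ = λ h → let a , b , _ = sound-graph h in a , b
    ; total = λ x∈A k → t x∈A λ (y , y∈B , r) → k (y , complete-graph x∈A y∈B r)
    ; functional = λ h h′ → let a , _ , r = sound-graph h ; _ , _ , r′ = sound-graph h′ in u a r r′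
    }
    where open Graph G

  record Bij (f A B : D) : Set where
    field
      fun  : IsFun f A B
      inj  : ∀ {x y z} → maps f x z → maps f y z → x Q y
      onto : ∀ {y} → y E B → M (Σ D λ x → maps f x y)
    open IsFun fun public

  eqv : D → D → Set
  eqv A B = ⟦ 0F ≈ 1F ⟧ (A ∷ B ∷ [])

  eqv-intro : ∀ {f A B} → Bij f A B → eqv A B
  eqv-intro {f} b k = k f (∧-intro (fun-intro fun)
    (∧-intro (λ x y z → inj) (λ y y∈B k → onto y∈B λ (x , h) → k x h)))
    where open Bij b

  eqv-elim : ∀ {A B} → eqv A B → M (Σ D λ f → Bij f A B)
  eqv-elim h k = do
    f , h′ ← ∃-elim h
    hf , h″ ← ∧-elim h′
    hi , ho ← ∧-elim h″
    F ← fun-elim hf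
    k (f , record { fun = F ; inj = hi _ _ _ ; onto = λ y∈B → ∃-elim (ho _ y∈B) })

  Empty : D → Set
  Empty x = ∀ z → Not (z E x)

  empty-ext : ∀ {x y} → Empty x → Empty y → x Q y
  empty-ext {x} {y} h h′ = ext λ z →
    (λ p → E-exf (h z p)) , (λ p → E-exf (h′ z p))

  empty-exists : M (Σ D Empty)
  empty-exists k = list-set [] λ (x , h) → k (x , λ z → proj₁ (h z))

  -- x = x′ ∪ {y} with y ∉ x′
  record Ins (x x′ y : D) : Set where
    field
      fresh : Not (y E x′)
      new   : y E x
      old   : ∀ {z} → z E x′ → z E x
      split : ∀ {z} → z E x → Not (z E x′) → z Q y

  ins-delete : ∀ {x y} → y E x → M (Σ D λ x′ → Ins x x′ y)
  ins-delete {x} {y} y∈x k = do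
    x′ , h ← sep (¬′ (0F ≐ 1F)) (y ∷ []) x
    k (x′ , record
      { fresh = λ p → proj₂ (proj₁ (h y) p) Q-refl
      ; new   = y∈x
      ; old   = λ p → proj₁ (proj₁ (h _) p)
      ; split = λ p n → Q-stable λ m → n (proj₂ (h _) (p , m)) })

  ins-add : ∀ {x′ y} → Not (y E x′) → M (Σ D λ x → Ins x x′ y)
  ins-add {x′} {y} y∉ k = do
    s , hs ← list-set (y ∷ [])
    x , h ← binary-union x′ s
    k (x , record
      { fresh = y∉
      ; new   = proj₂ (h y) λ _ → proj₂ (hs y) (∈ₗ-here [] Q-refl)
      ; old   = λ {z} p → proj₂ (h z) λ n → E-exf (n p)
      ; split = λ {z} p n → Q-stable λ k → proj₁ (hs z) (proj₁ (h z) p n) k })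

  eqv-empty : ∀ {x y} → Empty x → Empty y → eqv x y
  eqv-empty {x} {y} ex ey = stable (0F ≈ 1F) (x ∷ y ∷ []) λ k → do
    f , G ← graph ⊥′ [] x y
    k (eqv-intro record
      { fun = graph-fun G (λ p _ → ex _ p) (λ p _ _ → Q-exf (ex _ p))
      ; inj = λ h _ → Q-exf (proj₂ (proj₂ (Graph.sound-graph G h)))
      ; onto = λ p _ → ey _ p })

  empty-eqv : ∀ {x y} → Empty y → eqv x y → Empty x
  empty-eqv ey h z z∈x = do
    f , b ← eqv-elim h
    w , m ← Bij.total b z∈x
    ey w (proj₂ (Bij.maps-∈ b m))

  eqv-ins : ∀ {x x′ y N N′ w} → Ins x x′ y → Ins N N′ w → eqv x′ N′ → eqv x N
  eqv-ins {x} {x′} {y} {N} {N′} {w} I J h = stable (0F ≈ 1F) (x ∷ N ∷ []) λ k → do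
    f , b ← eqv-elim h
    let φ : Formula 5
        φ = Maps 2F 1F 0F ∨ (1F ≐ 3F ∧ 0F ≐ 4F)
        ρ = f ∷ y ∷ w ∷ []
        R : D → D → Set
        R u v = ⟦ φ ⟧ (v ∷ u ∷ ρ)
        left : ∀ {u v} → maps f u v → R u v
        left {u} {v} m n = exf (1F ≐ 3F ∧ 0F ≐ 4F) (v ∷ u ∷ ρ) (n m)
        right : R y w
        right n = ∧-intro Q-refl Q-refl
        elim : ∀ {u v} → R u v → M (maps f u v ⊎ (u Q y × v Q w))
        elim r k = ∨-elim r λ { (inj₁ m) → k (inj₁ m) ; (inj₂ h) → ∧-elim h λ q → k (inj₂ q) }
        y-fresh : ∀ {u v} → maps f u v → Not (u Q y)
        y-fresh m q = Ins.fresh I (E-respˡ q (proj₁ (Bij.maps-∈ b m)))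
        w-fresh : ∀ {u v} → maps f u v → Not (v Q w)
        w-fresh m q = Ins.fresh J (E-respˡ q (proj₂ (Bij.maps-∈ b m)))
    g , G ← graph φ ρ x N
    k (eqv-intro record
      { fun = graph-fun G
          (λ {u} u∈x k → lem (u E x′) λ
            { (inj₁ u∈x′) → Bij.total b u∈x′ λ (v , m) → k (v , Ins.old J (proj₂ (Bij.maps-∈ b m)) , left m)
            ; (inj₂ u∉x′) → k (w , Ins.new J , resp φ {w ∷ y ∷ ρ}
                (Q-refl ∷ Q-sym (Ins.split I u∈x u∉x′) ∷ Q*-refl) right) })
          (λ _ r r′ → Q-stable λ k → elim r λ
            { (inj₁ m) → elim r′ λ
              { (inj₁ m′) → k (Bij.functional b m m′)
              ; (inj₂ (q , _)) → y-fresh m q }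
            ; (inj₂ (q , s)) → elim r′ λ
              { (inj₁ m′) → y-fresh m′ q
              ; (inj₂ (_ , s′)) → k (Q-trans s (Q-sym s′)) } })
      ; inj = λ h h′ →
          let r = proj₂ (proj₂ (Graph.sound-graph G h)) ; r′ = proj₂ (proj₂ (Graph.sound-graph G h′))
          in Q-stable λ k → elim r λ
            { (inj₁ m) → elim r′ λ
              { (inj₁ m′) → k (Bij.inj b m m′)
              ; (inj₂ (_ , s)) → w-fresh m s }
            ; (inj₂ (q , s)) → elim r′ λ
              { (inj₁ m′) → w-fresh m′ s
              ; (inj₂ (q′ , _)) → k (Q-trans q (Q-sym q′)) } }
      ; onto = λ {v} v∈N k → lem (v E N′) λ
          { (inj₁ v∈N′) → Bij.onto b v∈N′ λ (u , m) →
              k (u , Graph.complete-graph G (Ins.old I (proj₁ (Bij.maps-∈ b m))) v∈N (left m))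
          ; (inj₂ v∉N′) → k (y , Graph.complete-graph G (Ins.new I) v∈N (resp φ {w ∷ y ∷ ρ}
                (Q-sym (Ins.split J v∈N v∉N′) ∷ Q*-refl) right)) } })

  -- The deleted point is the preimage of w, so the bijection only has to be restricted, never
  -- repaired.
  eqv-delete : ∀ {x N N′ w} → Ins N N′ w → eqv x N →
    M (Σ D λ x′ → Σ D λ y → Ins x x′ y × eqv x′ N′)
  eqv-delete {x} {N} {N′} {w} J h k = do
    f , b ← eqv-elim h
    y , m ← Bij.onto b (Ins.new J)
    x′ , I ← ins-delete (proj₁ (Bij.maps-∈ b m))
    g , G ← graph (Maps 2F 1F 0F) (f ∷ []) x′ N′
    let keeps : ∀ {u v} → u E x′ → maps f u v → v E N′
        keeps u∈x′ h = E-stable λ k → Ins.fresh I (E-respˡ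
          (Bij.inj b (maps-resp Q-refl (Ins.split J (proj₂ (Bij.maps-∈ b h)) k) h) m) u∈x′)
        keeps⁻ : ∀ {u v} → v E N′ → maps f u v → u E x′
        keeps⁻ v∈N′ h = E-stable λ k → Ins.fresh J (E-respˡ
          (Bij.functional b (maps-resp (Ins.split I (proj₁ (Bij.maps-∈ b h)) k) Q-refl h) m) v∈N′)
        in-f : ∀ {u v} → maps g u v → maps f u v
        in-f h = proj₂ (proj₂ (Graph.sound-graph G h))
    k (x′ , y , I , eqv-intro record
      { fun = graph-fun G
          (λ u∈x′ k → Bij.total b (Ins.old I u∈x′) λ (v , h) → k (v , keeps u∈x′ h , h))
          (λ _ → Bij.functional b)
      ; inj = λ h h′ → Bij.inj b (in-f h) (in-f h′)
      ; onto = λ v∈N′ k → Bij.onto b (Ins.old J v∈N′) λ (u , h) →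
          k (u , Graph.complete-graph G (keeps⁻ v∈N′ h) v∈N′ h) })

  -- Natural numbers

  -- Foundation for {x}. It makes x ∪ {x} a genuine insertion for every x, so successors are treated
  -- by `Ins` without a study of the members of ω.
  E-irrefl : ∀ x → Not (x E x)
  E-irrefl x x∈x = do
    s , h ← list-set (x ∷ [])
    y , y∈s , d ← ∃-∧-elim (zf foundation s (∃-intro x (proj₂ (h x) (∈ₗ-here [] Q-refl))))
    proj₁ (h y) y∈s λ y≐x → d (∃-∧-intro y (E-respʳ (Q-sym y≐x) (E-respˡ (Q-sym y≐x) x∈x)) y∈s)

  isSucc : D → D → Set
  isSucc y x = ⟦ IsSucc 0F 1F ⟧ (y ∷ x ∷ [])

  isSucc-ins : ∀ {y x} → isSucc y x → Ins y x x
  isSucc-ins {y} {x} h = record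
    { fresh = E-irrefl x
    ; new   = proj₂ (h′ x) λ _ → Q-refl
    ; old   = λ {z} p → proj₂ (h′ z) λ n → Q-exf (n p)
    ; split = λ p n → proj₁ (h′ _) p n }
    where
    h′ : ∀ z → z E y ↔ (Not (z E x) → z Q x)
    h′ z = ⇔-elim (0F ∈ 1F) (0F ∈ 2F ∨ 0F ≐ 2F) (z ∷ y ∷ x ∷ []) (h z)

  ins-isSucc : ∀ {y x} → Ins y x x → isSucc y x
  ins-isSucc {y} {x} I z = ∧-intro (Ins.split I) λ f → E-stable λ k → lem (z E x) λ
    { (inj₁ p) → k (Ins.old I p) ; (inj₂ n) → k (E-respˡ (Q-sym (f n)) (Ins.new I)) }

  succ-exists : ∀ x → M (Σ D λ y → isSucc y x)
  succ-exists x k = ins-add (E-irrefl x) λ (y , I) → k (y , ins-isSucc I)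

  succ-ext : ∀ {y y′ x} → isSucc y x → isSucc y′ x → y Q y′
  succ-ext {y} {y′} {x} s s′ = ext λ z → sub (isSucc-ins s) (isSucc-ins s′) , sub (isSucc-ins s′) (isSucc-ins s)
    where
    sub : ∀ {y y′ z} → Ins y x x → Ins y′ x x → z E y → z E y′
    sub {z = z} I J p = E-stable λ k → lem (z E x) λ
      { (inj₁ q) → k (Ins.old J q) ; (inj₂ n) → k (E-respˡ (Q-sym (Ins.split I p n)) (Ins.new J)) }

  isNat : D → Set
  isNat x = ⟦ IsNatural 0F ⟧ (x ∷ [])

  inductive-elim : ∀ {w} → ⟦ IsInductive 0F ⟧ (w ∷ []) →
    (∀ e → Empty e → e E w) × (∀ x y → x E w → isSucc y x → y E w)
  inductive-elim {w} h =
    (λ e he → E-stable λ k → ∧-elim h λ (h₁ , _) → ∃-∧-elim h₁ λ (e′ , e′∈w , he′) →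
      k (E-respˡ (empty-ext he′ he) e′∈w)) ,
    (λ x y x∈w s → E-stable λ k → ∧-elim h λ (_ , h₂) → ∃-∧-elim (h₂ x x∈w) λ (y′ , y′∈w , s′) →
      k (E-respˡ (succ-ext s′ s) y′∈w))

  nat-zero : ∀ {e} → Empty e → isNat e
  nat-zero he w ind = proj₁ (inductive-elim ind) _ he

  nat-suc : ∀ {x y} → isSucc y x → isNat x → isNat y
  nat-suc s nx w ind = proj₂ (inductive-elim ind) _ _ (nx w ind) s

  nat-ind : (φ : Formula (suc n)) (ρ : Vec D n) → (∀ {e} → Empty e → ⟦ φ ⟧ (e ∷ ρ)) →
    (∀ {x y} → isNat x → isSucc y x → ⟦ φ ⟧ (x ∷ ρ) → ⟦ φ ⟧ (y ∷ ρ)) → ∀ {x} → isNat x → ⟦ φ ⟧ (x ∷ ρ)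
  nat-ind φ ρ base step {x} nx = stable φ (x ∷ ρ) λ k → do
    I , indI ← ∃-elim (zf infinity)
    W , h ← sep (IsNatural 0F ∧ φ) ρ I
    e , he ← empty-exists
    let parts : ∀ {z} → z E W → (z E I) × isNat z × ⟦ φ ⟧ (z ∷ ρ)
        parts {z} p = let q , r = proj₁ (h z) p in q ,
          stable (IsNatural 0F) (z ∷ []) (λ k → ∧-elim r λ (a , _) → k a) ,
          stable φ (z ∷ ρ) (λ k → ∧-elim r λ (_ , b) → k b)
        I₀ , I₁ = inductive-elim indI
        indW = ∧-intro
          (∃-∧-intro e (proj₂ (h e) (I₀ e he , ∧-intro (nat-zero he) (base he))) he)
          (λ z z∈W → λ k → do
            let a , b , c = parts z∈W
            y , s ← succ-exists z
            k y (∧-intro (proj₂ (h y) (I₁ z y a s , ∧-intro (nat-suc s b) (step b s c))) s))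
    k (proj₂ (proj₂ (parts (nx W indW))))

  -- Finite sets

  fin : D → Set
  fin x = ⟦ Finite 0F ⟧ (x ∷ [])

  fin-stable : ∀ {x} → M (fin x) → fin x
  fin-stable {x} = stable (Finite 0F) (x ∷ [])

  fin-resp : ∀ {x y} → x Q y → fin x → fin y
  fin-resp p = resp (Finite 0F) (p ∷ [])

  fin-empty : ∀ {x} → Empty x → fin x
  fin-empty hx = fin-stable λ k → do
    e , he ← empty-exists
    k (∃-∧-intro e (nat-zero he) (eqv-empty hx he))

  fin-ins : ∀ {x x′ y} → Ins x x′ y → fin x′ → fin x
  fin-ins I h = fin-stable λ k → do
    N , nN , e ← ∃-∧-elim h
    N′ , s ← succ-exists N
    k (∃-∧-intro N′ (nat-suc s nN) (eqv-ins I (isSucc-ins s) e))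

  -- Induction on the numeral N, for all sets of that size at once, since deleting a point changes
  -- the set.
  fin-ind : (φ : Formula (suc n)) (ρ : Vec D n) → (∀ {x} → Empty x → ⟦ φ ⟧ (x ∷ ρ)) →
    (∀ {x x′ y} → Ins x x′ y → ⟦ φ ⟧ (x′ ∷ ρ) → ⟦ φ ⟧ (x ∷ ρ)) → ∀ {x} → fin x → ⟦ φ ⟧ (x ∷ ρ)
  fin-ind {n} φ ρ base step {x} h = stable φ (x ∷ ρ) λ k → do
    N , nN , e ← ∃-∧-elim h
    k (proj₁ (shift N x) (nat-ind ψ ρ
      (λ {N} hN x e → proj₂ (shift N x) (base (empty-eqv hN e)))
      (λ {M} {N} _ s ih x e → proj₂ (shift N x) (stable φ (x ∷ ρ) λ k → do
        x′ , y , I , e′ ← eqv-delete (isSucc-ins s) e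
        k (step I (proj₁ (shift M x′) (ih x′ e′)))))
      nN x e))
    where
    ψ : Formula (suc n)
    ψ = ∀′ 0F ≈ 1F ⇒ rename (lift 1 suc) φ
    shift : ∀ N x → ⟦ rename (lift 1 suc) φ ⟧ (x ∷ N ∷ ρ) ↔ ⟦ φ ⟧ (x ∷ ρ)
    shift N x = rename-⟦⟧ (lift 1 suc) (λ { zero → refl ; (suc i) → refl }) φ

  -- Each entry of L that lies in x but not yet in b is inserted into b in turn.
  fin-add : ∀ {b} → fin b → ∀ L {x} → (∀ z → z E b → z E x) →
    (∀ z → z E x → Not (z E b) → z ∈ₗ L) → fin x
  fin-add hb [] sub cov = fin-resp (ext λ z → sub z , λ p → E-stable (cov z p)) hb
  fin-add {b} hb (y ∷ L) {x} sub cov = fin-stable λ k → lem (y E x × Not (y E b)) λ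
    { (inj₁ (y∈x , y∉b)) → ins-add y∉b λ (b′ , I) →
        k (fin-add (fin-ins I hb) L
          (λ z p → E-stable λ k → lem (z E b) λ
            { (inj₁ q) → k (sub z q) ; (inj₂ n) → k (E-respˡ (Q-sym (Ins.split I p n)) y∈x) })
          (λ z p n → cov z p (λ q → n (Ins.old I q)) λ q → n (E-respˡ (Q-sym q) (Ins.new I))))
    ; (inj₂ n) → k (fin-add hb L sub λ z p m → cov z p m λ q →
        n (E-respˡ q p , λ r → m (E-respˡ (Q-sym q) r))) }

  -- A union of finite fibres over a finite index set is finite without choice: the induction on I
  -- lists a single fibre at each step, so the lists are never chosen simultaneously.
  fin-cover : (φ : Formula (2 + n)) (ρ : Vec D n) →
    (∀ i → M (Σ (List D) λ L → ∀ y → ⟦ φ ⟧ (y ∷ i ∷ ρ) → y ∈ₗ L)) →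
    ∀ {I} → fin I → ∀ {B} → (∀ y → y E B → M (Σ D λ i → i E I × ⟦ φ ⟧ (y ∷ i ∷ ρ))) → fin B
  fin-cover {n} φ ρ fibres {I} hI {B} cov = fin-ind ψ ρ
    (λ he B cov → fin-empty λ z z∈B → ∃-∧-elim (cov z z∈B) λ (i , i∈I , _) → he i i∈I)
    (λ {I} {I′} {j} ins ih B cov → fin-stable λ k → do
      B′ , h ← sep (∃∈[ 1F ] rename (ι) φ) (I′ ∷ ρ) B
      L , hL ← fibres j
      k (fin-add (ih B′ (λ y y∈B′ → λ k → ∃-∧-elim (proj₂ (proj₁ (h y) y∈B′)) λ (i , i∈I′ , r) →
            k i (∧-intro i∈I′ (proj₂ (shift B′ I′ y i) (proj₁ (shift₁ I′ y i) r)))))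
          L (λ z p → proj₁ (proj₁ (h z) p))
          (λ z z∈B z∉B′ → ∈ₗ-stable L λ k → ∃-∧-elim (cov z z∈B) λ (i , i∈I , r) → lem (i E I′) λ
            { (inj₁ i∈I′) → z∉B′ (proj₂ (h z) (z∈B , ∃-∧-intro i i∈I′
                (proj₂ (shift₁ I′ z i) (proj₁ (shift B I z i) r))))
            ; (inj₂ i∉I′) → k (hL z (resp φ (Q-refl ∷ Ins.split ins i∈I i∉I′ ∷ Q*-refl)
                (proj₁ (shift B I z i) r))) })))
    hI B (λ y y∈B k → cov y y∈B λ (i , i∈I , r) → k i (∧-intro i∈I (proj₂ (shift B I y i) r)))
    where
    κ : Fin (2 + n) → Fin (4 + n)
    κ 0F            = 1F
    κ 1F            = 0F
    κ (suc (suc i)) = 4 ↑ʳ i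
    ι : Fin (2 + n) → Fin (3 + n)
    ι 0F            = 1F
    ι 1F            = 0F
    ι (suc (suc i)) = 3 ↑ʳ i
    ψ : Formula (suc n)
    ψ = ∀′ (∀∈[ 0F ] ∃∈[ 2F ] rename κ φ) ⇒ Finite 0F
    shift : ∀ B I y i → ⟦ rename κ φ ⟧ (i ∷ y ∷ B ∷ I ∷ ρ) ↔ ⟦ φ ⟧ (y ∷ i ∷ ρ)
    shift B I y i = rename-⟦⟧ κ (λ { 0F → refl ; 1F → refl ; (suc (suc i)) → refl }) φ
    shift₁ : ∀ I y i → ⟦ rename ι φ ⟧ (i ∷ y ∷ I ∷ ρ) ↔ ⟦ φ ⟧ (y ∷ i ∷ ρ)
    shift₁ I y i = rename-⟦⟧ ι (λ { 0F → refl ; 1F → refl ; (suc (suc i)) → refl }) φ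

  fin-subset : ∀ {x y} → (∀ z → z E x → z E y) → fin y → fin x
  fin-subset sub hy = fin-cover (0F ≐ 1F) []
    (λ i k → k (i ∷ [] , λ y → ∈ₗ-here [])) hy
    (λ y y∈x k → k (y , sub y y∈x , Q-refl))

  -- Sets of standard size

  rename-IsNumeral : ∀ {k l} (σ : Fin k → Fin l) m x → rename σ (IsNumeral m x) ≡ IsNumeral m (σ x)
  rename-IsNumeral σ zero    x = refl
  rename-IsNumeral σ (suc m) x = cong (λ φ → ∃′ φ ∧ IsSucc (suc (σ x)) 0F)
    (rename-IsNumeral (lift 1 σ) m 0F)

  rename-HasSize : ∀ {k l} (σ : Fin k → Fin l) m x → rename σ (HasSize m x) ≡ HasSize m (σ x)
  rename-HasSize σ m x = cong (λ φ → ∃′ φ ∧ suc (σ x) ≈ 0F) (rename-IsNumeral (lift 1 σ) m 0F)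

  rename-HasSize≤ : ∀ {k l} (σ : Fin k → Fin l) m x → rename σ (HasSize≤ m x) ≡ HasSize≤ m (σ x)
  rename-HasSize≤ σ m x = cong (λ φ → ∃′ φ ∧ suc (σ x) ≼ 0F) (rename-IsNumeral (lift 1 σ) m 0F)

  -- For a variable m, `rename` does not compute through `HasSize m`. Renaming from a single
  -- variable brings such predicates into a one-entry environment, where they can be compared.
  at-variable : (P : ∀ {n} → Fin n → Formula n) →
    (∀ {k l} (σ : Fin k → Fin l) x → rename σ (P x) ≡ P (σ x)) →
    ∀ {n} (ρ : Vec D n) x → ⟦ P x ⟧ ρ ↔ ⟦ P 0F ⟧ (lookup ρ x ∷ [])
  at-variable P eq ρ x with rename-⟦⟧ (λ _ → x) {ρ} {lookup ρ x ∷ []} (λ { 0F → refl }) (P 0F)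
  ... | f , g rewrite eq {1} (λ _ → x) 0F = f , g

  numeral : ℕ → D → Set
  numeral m N = ⟦ IsNumeral m 0F ⟧ (N ∷ [])

  numeral-at : ∀ m (ρ : Vec D n) x → ⟦ IsNumeral m x ⟧ ρ ↔ numeral m (lookup ρ x)
  numeral-at m = at-variable (IsNumeral m) (λ σ → rename-IsNumeral σ m)

  numeral-suc : ∀ {m N N′} → numeral m N → isSucc N′ N → numeral (suc m) N′
  numeral-suc {m} {N} {N′} h s = ∃-∧-intro N (proj₂ (numeral-at m (N ∷ N′ ∷ []) 0F) h) s

  numeral-pred : ∀ {m N′} → numeral (suc m) N′ → M (Σ D λ N → numeral m N × isSucc N′ N)
  numeral-pred {m} {N′} h k = ∃-∧-elim h λ (N , h , s) → k (N , proj₁ (numeral-at m (N ∷ N′ ∷ []) 0F) h , s)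

  numeral-exists : ∀ m → M (Σ D (numeral m))
  numeral-exists zero    k = empty-exists k
  numeral-exists (suc m) k = do
    N , h ← numeral-exists m
    N′ , s ← succ-exists N
    k (N′ , numeral-suc {m} h s)

  numeral-below : ∀ {m r R} → numeral r R → m ≤′ r → M (Σ D λ N → numeral m N × (∀ z → z E N → z E R))
  numeral-below {R = R} h ≤′-refl k = k (R , h , λ z → id)
  numeral-below {r = suc r} h (≤′-step le) k = do
    R′ , h′ , s ← numeral-pred {r} h
    N , hN , sub ← numeral-below h′ le
    k (N , hN , λ z p → Ins.old (isSucc-ins s) (sub z p))

  -- An insertion history, which mediates between lists and bijections with numerals: both grow by
  -- one insertion at a time.
  data Enum : List D → D → Set where
    []  : ∀ {x} → Empty x → Enum [] x
    _∷_ : ∀ {L x x′ y} → Ins x x′ y → Enum L x′ → Enum (y ∷ L) x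

  enum-eqv : ∀ {L x N} → Enum L x → numeral (length L) N → eqv x N
  enum-eqv ([] h) hN = eqv-empty h hN
  enum-eqv {y ∷ L} {x} {N} (I ∷ e) hN = stable (0F ≈ 1F) (x ∷ N ∷ []) λ k → do
    N′ , hN′ , s ← numeral-pred {length L} hN
    k (eqv-ins I (isSucc-ins s) (enum-eqv e hN′))

  eqv-enum : ∀ m {x N} → numeral m N → eqv x N → M (Σ (List D) λ L → length L ≡ m × Enum L x)
  eqv-enum zero    hN e k = k ([] , refl , [] (empty-eqv hN e))
  eqv-enum (suc m) hN e k = do
    N′ , hN′ , s ← numeral-pred {m} hN
    x′ , y , I , e′ ← eqv-delete (isSucc-ins s) e
    L , eq , en ← eqv-enum m hN′ e′
    k (y ∷ L , cong suc eq , I ∷ en)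

  enum-lists : ∀ {L x} → Enum L x → L lists x × Distinct L
  enum-lists ([] h) = (λ z → h z , E-exf) , tt
  enum-lists {y ∷ L} {x} (_∷_ {x′ = x′} I e) =
    (λ z → (λ p n → ∈ₗ-stable L λ k → lem (z E x′) λ
              { (inj₁ q) → k (proj₁ (h z) q) ; (inj₂ m) → n (Ins.split I p m) }) ,
           (λ f → E-stable λ k → lem (z Q y) λ
              { (inj₁ q) → k (E-respˡ (Q-sym q) (Ins.new I))
              ; (inj₂ n) → k (Ins.old I (proj₂ (h z) (f n))) })) ,
    (λ y∈L → Ins.fresh I (proj₂ (h y) y∈L)) , d
    where
    h = proj₁ (enum-lists e)
    d = proj₂ (enum-lists e)

  lists-enum : ∀ {L x} → L lists x → Distinct L → M (Enum L x)
  lists-enum {[]} h _ k = k ([] λ z → proj₁ (h z))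
  lists-enum {y ∷ L} {x} h (y∉L , d) k = do
    x′ , h′ ← list-set L
    e ← lists-enum h′ d
    k (record
      { fresh = λ p → y∉L (proj₁ (h′ y) p)
      ; new   = proj₂ (h y) (∈ₗ-here L Q-refl)
      ; old   = λ {z} p → proj₂ (h z) λ _ → proj₁ (h′ z) p
      ; split = λ {z} p n → Q-stable λ m → n (proj₂ (h′ z) (proj₁ (h z) p m)) } ∷ e)

  size : ℕ → D → Set
  size m x = ⟦ HasSize m 0F ⟧ (x ∷ [])

  size-at : ∀ m (ρ : Vec D n) x → ⟦ HasSize m x ⟧ ρ ↔ size m (lookup ρ x)
  size-at m = at-variable (HasSize m) (λ σ → rename-HasSize σ m)

  size-elim : ∀ {m x} → size m x → M (Σ (List D) λ L → length L ≡ m × L lists x × Distinct L)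
  size-elim {m} {x} h k = do
    N , hN , e ← ∃-∧-elim h
    L , eq , en ← eqv-enum m (proj₁ (numeral-at m (N ∷ x ∷ []) 0F) hN) e
    k (L , eq , enum-lists en)

  size-intro : ∀ L {x} → L lists x → Distinct L → size (length L) x
  size-intro L {x} h d = stable (HasSize (length L) 0F) (x ∷ []) λ k → do
    N , hN ← numeral-exists (length L)
    en ← lists-enum h d
    k (∃-∧-intro N (proj₂ (numeral-at (length L) (N ∷ x ∷ []) 0F) hN) (enum-eqv en hN))

  dedup : ∀ L x → (∀ z → z E x → z ∈ₗ L) → M (Σ (List D) λ L′ → length L′ ≤ length L × Enum L′ x)
  dedup []      x cov k = k ([] , z≤n , [] cov)
  dedup (y ∷ L) x cov k = lem (y E x) λ
    { (inj₁ y∈x) → ins-delete y∈x λ (x′ , I) →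
        dedup L x′ (λ z p → cov z (Ins.old I p) λ q → Ins.fresh I (E-respˡ q p)) λ (L′ , le , e) →
        k (y ∷ L′ , s≤s le , I ∷ e)
    ; (inj₂ y∉x) → dedup L x (λ z p → cov z p λ q → y∉x (E-respˡ q p)) λ (L′ , le , e) →
        k (L′ , m≤n⇒m≤1+n le , e) }

  size≤ : ℕ → D → Set
  size≤ m x = ⟦ HasSize≤ m 0F ⟧ (x ∷ [])

  size≤-at : ∀ m (ρ : Vec D n) x → ⟦ HasSize≤ m x ⟧ ρ ↔ size≤ m (lookup ρ x)
  size≤-at m = at-variable (HasSize≤ m) (λ σ → rename-HasSize≤ σ m)

  size≤-intro : ∀ {r} L {x} → (∀ z → z E x → z ∈ₗ L) → length L ≤ r → size≤ r x
  size≤-intro {r} L {x} cov le = stable (HasSize≤ r 0F) (x ∷ []) λ k → do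
    R , hR ← numeral-exists r
    L′ , le′ , en ← dedup L x cov
    N , hN , sub ← numeral-below hR (≤⇒≤′ (≤-trans le′ le))
    f , b ← eqv-elim (enum-eqv en hN)
    let open Bij b
    k (∃-∧-intro R (proj₂ (numeral-at r (R ∷ x ∷ []) 0F) hR) (∃-∧-intro f
      (fun-intro record
        { pairs = λ p p∈f k → pairs p p∈f λ (u , v , u∈x , v∈N , o) → k (u , v , u∈x , sub v v∈N , o)
        ; maps-∈ = λ m → let u∈x , v∈N = maps-∈ m in u∈x , sub _ v∈N
        ; total = total
        ; functional = functional })
      (λ u v w → inj)))

  -- Rainbow Ramsey for colorings given by relations

  infix 4 _⊑_
  _⊑_ : D → D → Set
  x ⊑ y = ∀ z → z E x → z E y

  _∈[_^_] : D → D → ℕ → Set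
  s ∈[ X ^ m ] = s ⊑ X × size m s

  Rel : Formula (2 + n) → Vec D n → D → D → Set
  Rel φ ρ s t = ⟦ φ ⟧ (t ∷ s ∷ ρ)

  -- The color of s is its class {u ∈ [X]ᵐ : Rel φ ρ s u}.
  -- The infinite set A only serves to make the set of colors infinite.
  rainbow : ∀ m b → ⟦ RRT m b ⟧ [] → (φ : Formula (2 + n)) (ρ : Vec D n) →
    ∀ {X A} → Not (fin X) → Not (fin A) →
    (∀ s → s ∈[ X ^ m ] → Rel φ ρ s s) →
    (∀ s → s ∈[ X ^ m ] → M (Σ (List D) λ L → length L ≤ b ×
      ∀ t → t ∈[ X ^ m ] → Rel φ ρ s t → t ∈ₗ L)) →
    M (Σ D λ Y → Y ⊑ X × Not (fin Y) ×
      ∀ s t → s ∈[ Y ^ m ] → t ∈[ Y ^ m ] → (∀ u → u ∈[ X ^ m ] → Rel φ ρ s u ↔ Rel φ ρ t u) → s Q t)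
  rainbow {n} m b rrt φ ρ {X} {A} infX infA R-refl R-class k = do
    P , hP ← power-set X
    S , hS′ ← sep (HasSize m 0F) [] P
    K , hK ← power-set S
    Colors , hC ← binary-union K A
    χ , G ← graph ψ (S ∷ ρ) S Colors
    let hS : ∀ z → z E S ↔ (z ∈[ X ^ m ])
        hS z = (λ p → let q , r = proj₁ (hS′ z) p in proj₁ (hP z) q , r) ,
               (λ (q , r) → proj₂ (hS′ z) (proj₂ (hP z) q , r))
        R : D → D → Set
        R = Rel φ ρ
        Col : D → D → Set
        Col s c = ∀ u → u E c ↔ (u E S × R s u)
        to : ∀ {s c} → ⟦ ψ ⟧ (c ∷ s ∷ S ∷ ρ) → Col s c
        to {s} {c} h u =
          let τ = u ∷ c ∷ s ∷ S ∷ ρ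
              f , g = ⇔-elim (0F ∈ 1F) (0F ∈ 3F ∧ rename κ φ) τ (h u)
          in (λ p → E-stable (λ k → f p λ q _ → k q) ,
                proj₁ (shift S u c s) (stable (rename κ φ) τ λ k → f p λ _ q → k q)) ,
             (λ (p , q) → g (∧-intro p (proj₂ (shift S u c s) q)))
        from : ∀ {s c} → Col s c → ⟦ ψ ⟧ (c ∷ s ∷ S ∷ ρ)
        from {s} {c} h u = ∧-intro
          (λ p → let q , r = proj₁ (h u) p in ∧-intro q (proj₂ (shift S u c s) r))
          (λ h′ → E-stable λ k → ∧-elim h′ λ (q , r) → k (proj₂ (h u) (q , proj₁ (shift S u c s) r)))
        col : ∀ {s c} → maps χ s c → Col s c
        col h = to (proj₂ (proj₂ (Graph.sound-graph G h)))
        in-S : ∀ {s c} → maps χ s c → s E S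
        in-S h = proj₁ (Graph.sound-graph G h)
        infC : Not (fin Colors)
        infC h = infA (fin-subset (λ z p → proj₂ (hC z) λ _ → p) h)
        χ-fun : IsFun χ S Colors
        χ-fun = graph-fun G
          (λ {s} s∈S k → sep φ (s ∷ ρ) S λ (c , hc) →
            k (c , proj₂ (hC c) (λ n → E-exf (n (proj₂ (hK c) λ v p → proj₁ (proj₁ (hc v) p)))) , from hc))
          (λ {s} {c} {d} _ hc hd → ext λ u →
            (λ p → proj₂ (to hd u) (proj₁ (to hc u) p)) , (λ p → proj₂ (to hc u) (proj₁ (to hd u) p)))
        bounded : ⟦ Bounded b 0F 2F ⟧ (χ ∷ S ∷ Colors ∷ X ∷ [])
        bounded c c∈C w hw = proj₂ (size≤-at b _ 0F) (stable (HasSize≤ b 0F) (w ∷ []) λ k →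
          lem (Σ D λ s → s E w) λ
          { (inj₁ (s , s∈w)) →
              let hw′ : ∀ {t} → t E w → maps χ t c
                  hw′ {t} = proj₁ (⇔-elim (0F ∈ 1F) (Maps 3F 0F 2F)
                    (t ∷ w ∷ c ∷ χ ∷ S ∷ Colors ∷ X ∷ []) (hw t))
              in R-class s (proj₁ (hS s) (in-S (hw′ s∈w))) λ (L , le , hL) → k (size≤-intro L
                -- By reflexivity t lies in its own class; that class is c, which is also the class
                -- of s.
                (λ t t∈w → let t∈S = in-S (hw′ t∈w) ; t∈[X] = proj₁ (hS t) t∈S in
                  hL t t∈[X] (proj₂ (proj₁ (col (hw′ s∈w) t)
                    (proj₂ (col (hw′ t∈w) t) (t∈S , R-refl t t∈[X]))))) le)
          ; (inj₂ none) → k (size≤-intro {b} [] (λ t t∈w → none (t , t∈w)) z≤n) })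
        subsets : ⟦ 1F ≐[ 3F ]^ m ⟧ (χ ∷ S ∷ Colors ∷ X ∷ [])
        subsets z = ∧-intro
          (λ p → let q , r = proj₁ (hS z) p in ∧-intro q (proj₂ (size-at m _ 0F) r))
          (λ h → E-stable λ k → ∧-elim h λ (q , r) → k (proj₂ (hS z) (q , proj₁ (size-at m _ 0F) r)))
    Y , hY ← ∃-elim (rrt X Colors S χ infX infC subsets (fun-intro χ-fun) bounded)
    Y⊑X , hY′ ← ∧-elim hY
    infY , poly ← ∧-elim hY′
    k (Y , Y⊑X , infY , λ s t hs ht same → Q-stable λ s≢t → do
      let s∈S = proj₂ (hS s) ((λ z p → Y⊑X z (proj₁ hs z p)) , proj₂ hs)
          t∈S = proj₂ (hS t) ((λ z p → Y⊑X z (proj₁ ht z p)) , proj₂ ht)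
      c , sc ← IsFun.total χ-fun s∈S
      -- Since the classes agree, c is the color of t as well, which `poly` forbids for s ≢ t.
      let tc = Graph.complete-graph G t∈S (proj₁ (proj₂ (Graph.sound-graph G sc))) (from λ u →
                 (λ p → let q , r = proj₁ (col sc u) p in q , proj₁ (same u (proj₁ (hS u) q)) r) ,
                 (λ (q , r) → proj₂ (col sc u) (q , proj₂ (same u (proj₁ (hS u) q)) r)))
      poly s t (∧-intro (proj₁ hs) (proj₂ (size-at m (t ∷ s ∷ Y ∷ χ ∷ S ∷ Colors ∷ X ∷ []) 1F) (proj₂ hs)))
               (∧-intro (proj₁ ht) (proj₂ (size-at m _ 0F) (proj₂ ht))) s≢t c c sc tc Q-refl)
    where
    κ : Fin (2 + n) → Fin (4 + n)
    κ 0F            = 0F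
    κ 1F            = 2F
    κ (suc (suc i)) = 4 ↑ʳ i
    ψ : Formula (3 + n)
    ψ = ∀′ (0F ∈ 1F ⇔ 0F ∈ 3F ∧ rename κ φ)
    shift : ∀ S u c s → ⟦ rename κ φ ⟧ (u ∷ c ∷ s ∷ S ∷ ρ) ↔ ⟦ φ ⟧ (u ∷ s ∷ ρ)
    shift S u c s = rename-⟦⟧ κ (λ { 0F → refl ; 1F → refl ; (suc (suc i)) → refl }) φ

  fin-list : ∀ L {x} → (∀ z → z E x → z ∈ₗ L) → fin x
  fin-list L cov = fin-stable λ k → empty-exists λ (e , he) →
    k (fin-add (fin-empty he) L (λ z p → E-exf (he z p)) (λ z p _ → cov z p))

  fin-union : ∀ {a b} → fin a → fin b → ∀ {x} → (∀ z → z E x → Not (z E a) → z E b) → fin x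
  fin-union {a} {b} ha hb {x} cov = fin-ind ψ (a ∷ [])
    (λ he x cov → fin-subset (λ z p → E-stable λ m → he z (cov z p m)) ha)
    (λ {b} {b′} {y} I ih x cov → fin-stable λ k → do
      x′ , h ← sep (¬′ (0F ≐ 1F)) (y ∷ []) x
      k (fin-add (ih x′ λ z p m → let z∈x , z≢y = proj₁ (h z) p in
            E-stable λ n → z≢y (Ins.split I (cov z z∈x m) n))
          (y ∷ []) (λ z p → proj₁ (proj₁ (h z) p))
          (λ z p n m → n (proj₂ (h z) (p , m)))))
    hb x cov
    where
    ψ : Formula 2
    ψ = ∀′ (∀∈[ 0F ] 0F ∈ 3F ∨ 0F ∈ 2F) ⇒ Finite 0F

  -- Greedy search: the list is lengthened by new individuals until none is left, and `none`
  -- prevents it from reaching length N.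
  exhaust : (P : D → Set) (N : ℕ) → (∀ {L} → length L ≡ N → Distinct L → All P L → Bot) →
    M (Σ (List D) λ L → ∀ a → P a → a ∈ₗ L)
  exhaust P N none k = extend N [] refl tt []
    where
    extend : ∀ j L → length L + j ≡ N → Distinct L → All P L → Bot
    extend zero    L eq d ps = none (trans (sym (+-identityʳ _)) eq) d ps
    extend (suc j) L eq d ps = lem (Σ D λ a → P a × (a ∉ₗ L)) λ
      { (inj₁ (a , p , a∉)) → extend j (a ∷ L) (trans (sym (+-suc _ j)) eq) (a∉ , d) (p ∷ ps)
      ; (inj₂ n) → k (L , λ a p → ∈ₗ-stable L λ a∉ → n (a , p , a∉)) }

  -- Disjoint copies of a family of finite sets

  -- The point z belongs to the copy of a when z = ⟨a , x⟩ for some x. The first component makes the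
  -- copies disjoint.
  Fib : (z a : Fin n) → Formula n
  Fib z a = ∃′ IsOrderedPair (suc z) (suc a) 0F

  fib : D → D → Set
  fib z a = ⟦ Fib 0F 1F ⟧ (z ∷ a ∷ [])

  fib-elim : ∀ {z a} → fib z a → M (Σ D (opair z a))
  fib-elim h = ∃-elim h

  fib-unique : ∀ {z a b} → fib z a → fib z b → a Q b
  fib-unique h h′ = Q-stable λ k → do
    x , o ← fib-elim h
    y , o′ ← fib-elim h′
    k (proj₁ (opair-inj o o′))

  fib-resp : ∀ {z z′ a a′} → z Q z′ → a Q a′ → fib z a → fib z′ a′
  fib-resp p q = resp (Fib 0F 1F) (p ∷ q ∷ [])

  Selector : D → D → Set
  Selector A B = B ⊑ A × Not (fin B) × ⟦ HasChoiceFunction 0F ⟧ (B ∷ [])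

  -- Over a two-element member this says that the other point of the fibre of z lies in s.
  Partner : ∀ {k} → (z s : Fin k) → Formula k
  Partner z s = ∃∈[ s ] ¬′ (0F ≐ suc z) ∧ (∃′ Fib 1F 0F ∧ Fib (2 ↑ʳ z) 0F)

  Flip : ∀ {k} → (s t X : Fin k) → Formula k
  Flip s t X = ∀∈[ X ] (0F ∈ suc t ⇔ Partner 0F (suc s))

  -- At most two points of s over each a, expressed by a cover {x , y} in place of a count.
  Thin : ∀ {k} → Fin k → Formula k
  Thin s = ∀′ ∃′ ∃′ ∀∈[ 3 ↑ʳ s ] Fib 0F 3F ⇒ 0F ≐ 2F ∨ 0F ≐ 1F

  Support : ∀ {k} → (s σ : Fin k) → Formula k
  Support s σ = ∀′ (0F ∈ suc σ ⇔ (∃∈[ suc s ] Fib 0F 1F))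

  Spec : ∀ {k} → (s σ : Fin k) → Formula k
  Spec s σ = Thin s ∧ Support s σ

  thin-elim : ∀ {s} → ⟦ Thin 0F ⟧ (s ∷ []) → ∀ a → M (Σ D λ x → Σ D λ y →
    ∀ z → z E s → fib z a → Not (z Q x) → z Q y)
  thin-elim h a k = h a λ x h′ → h′ λ y h″ → k (x , y , h″)

  thin-intro : ∀ {s} → (∀ a → M (Σ D λ x → Σ D λ y →
    ∀ z → z E s → fib z a → Not (z Q x) → z Q y)) → ⟦ Thin 0F ⟧ (s ∷ [])
  thin-intro h a k = h a λ (x , y , f) → k x λ k → k y f

  support-elim : ∀ {s σ} → ⟦ Support 0F 1F ⟧ (s ∷ σ ∷ []) → ∀ a → a E σ ↔ M (Σ D λ z → z E s × fib z a)
  support-elim {s} {σ} h a =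
    let f , g = ⇔-elim (0F ∈ 2F) (∃∈[ 1F ] Fib 0F 1F) (a ∷ s ∷ σ ∷ []) (h a)
    in (λ p → ∃-∧-elim (f p)) , (λ m → g λ k → m λ (z , z∈s , hz) → ∃-∧-intro z z∈s hz k)

  support-intro : ∀ {s σ} → (∀ a → a E σ ↔ M (Σ D λ z → z E s × fib z a)) → ⟦ Support 0F 1F ⟧ (s ∷ σ ∷ [])
  support-intro h a = ∧-intro
    (λ p k → proj₁ (h a) p λ (z , z∈s , hz) → ∃-∧-intro z z∈s hz k)
    (λ e → proj₂ (h a) (∃-∧-elim e))

  spec : D → D → Set
  spec s σ = ⟦ Spec 0F 1F ⟧ (s ∷ σ ∷ [])

  spec-support : ∀ {s σ} → spec s σ → ∀ a → a E σ ↔ M (Σ D λ z → z E s × fib z a)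
  spec-support {s} {σ} h = support-elim (stable (Support 0F 1F) (s ∷ σ ∷ []) λ k → ∧-elim h λ (_ , q) → k q)

  spec-thin : ∀ {s σ} → spec s σ → ⟦ Thin 0F ⟧ (s ∷ [])
  spec-thin {s} {σ} h = stable (Thin 0F) (s ∷ []) λ k → ∧-elim h λ (p , _) → k p

  support-unique : ∀ {s σ τ} → spec s σ → spec s τ → σ Q τ
  support-unique h h′ = ext λ a →
    (λ p → proj₂ (spec-support h′ a) (proj₁ (spec-support h a) p)) ,
    (λ p → proj₂ (spec-support h a) (proj₁ (spec-support h′ a) p))

  spec-resp : ∀ {s s′ σ σ′} → s Q s′ → σ Q σ′ → spec s σ → spec s′ σ′
  spec-resp p q = resp (Spec 0F 1F) (p ∷ q ∷ [])

  -- The equality disjunct leaves sets without a suitable support in a class of their own. The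
  -- formula mentions neither p nor q: if s has m = 2p + q points, at most two over each of N = p +
  -- q members, then the numbers of double and single fibres are forced.
  SameSupport : ℕ → Formula 2
  SameSupport N = 1F ≐ 0F ∨ (∃′ HasSize N 0F ∧ Spec 2F 0F ∧ Spec 1F 0F)

  same-intro : ∀ {N s t σ} → size N σ → spec s σ → spec t σ → Rel (SameSupport N) [] s t
  same-intro {N} {s} {t} {σ} hσ hs ht _ = ∃-∧-intro σ (proj₂ (size-at N (σ ∷ t ∷ s ∷ []) 0F) hσ) (∧-intro hs ht)

  same-elim : ∀ {N s t} → Rel (SameSupport N) [] s t →
    M (s Q t ⊎ Σ D λ σ → size N σ × spec s σ × spec t σ)
  same-elim {N} {s} {t} h k = ∨-elim h λ
    { (inj₁ p) → k (inj₁ p)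
    ; (inj₂ h) → ∃-∧-elim h λ (σ , hσ , h′) → ∧-elim h′ λ (hs , ht) →
        k (inj₂ (σ , proj₁ (size-at N (σ ∷ t ∷ s ∷ []) 0F) hσ , hs , ht)) }

  same-refl : ∀ {N} s → Rel (SameSupport N) [] s s
  same-refl {N} s n = exf (∃′ HasSize N 0F ∧ Spec 2F 0F ∧ Spec 1F 0F) (s ∷ s ∷ []) (n Q-refl)

  same-stable : ∀ {N s t} → M (Rel (SameSupport N) [] s t) → Rel (SameSupport N) [] s t
  same-stable {N} {s} {t} = stable (SameSupport N) (t ∷ s ∷ [])

  same-class : ∀ {N s t σ} → size N σ → spec s σ → spec t σ →
    ∀ u → Rel (SameSupport N) [] s u → Rel (SameSupport N) [] t u
  same-class {N} hσ hs ht u h = same-stable {N} λ k → same-elim {N} h λ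
    { (inj₁ s≐u) → k (same-intro {N} hσ ht (spec-resp s≐u Q-refl hs))
    ; (inj₂ (τ , _ , hs′ , hu)) → k (same-intro {N} hσ ht (spec-resp Q-refl (support-unique hs′ hs) hu)) }

  -- `selections` consists of literal entries, whereas points are known only up to `_Q_`; each must
  -- be traded for an equal entry of its list.
  ∈ₗ-literal : ∀ {z} L → z ∈ₗ L → M (Σ D λ u → u ∈ᴸ L × z Q u)
  ∈ₗ-literal []      h k = h
  ∈ₗ-literal {z} (y ∷ L) h k = lem (z Q y) λ
    { (inj₁ p) → k (y , here refl , p)
    ; (inj₂ n) → ∈ₗ-literal L (h n) λ (u , i , p) → k (u , there i , p) }

  twoSubsets-literal : ∀ {x y} L → x ∈ₗ L → y ∈ₗ L → Not (x Q y) →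
    M (Σ D λ u → Σ D λ v → (u , v) ∈ᴸ twoSubsets L × ((x Q u × y Q v) ⊎ (x Q v × y Q u)))
  twoSubsets-literal []      hx hy n k = hx
  twoSubsets-literal {x} {y} (a ∷ L) hx hy n k = lem (x Q a) λ
    { (inj₁ p) → ∈ₗ-literal L (hy λ q → n (Q-trans p (Q-sym q))) λ (v , i , q) →
        k (a , v , ∈-++⁺ˡ (∈-map⁺ (a ,_) i) , inj₁ (p , q))
    ; (inj₂ x≢a) → lem (y Q a) λ
      { (inj₁ p) → ∈ₗ-literal L (hx x≢a) λ (v , i , q) →
          k (a , v , ∈-++⁺ˡ (∈-map⁺ (a ,_) i) , inj₂ (q , p))
      ; (inj₂ y≢a) → twoSubsets-literal L (hx x≢a) (hy y≢a) n λ (u , v , i , q) →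
          k (u , v , ∈-++⁺ʳ (map (a ,_) L) i , q) } }

  list-sets : (Ls : List (List D)) → M (Σ (List D) λ ds → length ds ≡ length Ls ×
    (∀ {L t} → L ∈ᴸ Ls → L lists t → t ∈ₗ ds))
  list-sets []       k = k ([] , refl , λ ())
  list-sets (L ∷ Ls) k = do
    d , hd ← list-set L
    ds , eq , h ← list-sets Ls
    k (d ∷ ds , cong suc eq , λ
      { (here refl) ht → ∈ₗ-here ds (ext λ z → (proj₂ (hd z) ∘ proj₁ (ht z)) , (proj₂ (ht z) ∘ proj₁ (hd z)))
      ; (there i) ht _ → h i ht })

  Partnered : D → D → Set
  Partnered s z = M (Σ D λ w → Σ D λ a → w E s × Not (w Q z) × fib w a × fib z a)

  partner : ∀ {z s} → ⟦ Partner 0F 1F ⟧ (z ∷ s ∷ []) ↔ Partnered s z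
  partner =
    (λ h k → ∃-∧-elim h λ (w , w∈s , h′) → ∧-elim h′ λ (w≢z , h″) → ∃-∧-elim h″ λ (a , hw , hz) →
      k (w , a , w∈s , w≢z , hw , hz)) ,
    (λ m k → m λ (w , a , w∈s , w≢z , hw , hz) →
      ∃-∧-intro w w∈s (∧-intro w≢z (∃-∧-intro a hw hz)) k)

  flips : D → D → D → Set
  flips X s t = ⟦ Flip 0F 1F 2F ⟧ (s ∷ t ∷ X ∷ [])

  flips-intro : ∀ {X s t} → (∀ z → z E X → z E t ↔ Partnered s z) → flips X s t
  flips-intro h z z∈X = let f , g = h z z∈X in ∧-intro (λ p → proj₂ partner (f p)) (λ q → g (proj₁ partner q))

  flips-elim : ∀ {X s t} → flips X s t → ∀ z → z E X → z E t ↔ Partnered s z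
  flips-elim {X} {s} {t} h z z∈X =
    let f , g = ⇔-elim (0F ∈ 2F) (Partner 0F 1F) (z ∷ s ∷ t ∷ X ∷ []) (h z z∈X)
    in (λ p → proj₁ partner (f p)) , (λ q → g (proj₂ partner q))

  flips-unique : ∀ {X s t u} → t ⊑ X → u ⊑ X → flips X s t → flips X s u → t Q u
  flips-unique t⊑X u⊑X h h′ = ext λ z →
    (λ p → proj₂ (flips-elim h′ z (t⊑X z p)) (proj₁ (flips-elim h z (t⊑X z p)) p)) ,
    (λ p → proj₂ (flips-elim h z (u⊑X z p)) (proj₁ (flips-elim h′ z (u⊑X z p)) p))

  EqualOrFlipped : Formula 3
  EqualOrFlipped = 1F ≐ 0F ∨ Flip 1F 0F 2F

  -- The disjoint union X is the graph of membership between A and its union U. Sizes are written as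
  -- successors, so every member contributes a point to X.
  module Family (n : ℕ) (A : D) (infA : Not (fin A)) (sizes : ∀ a → a E A → size (suc n) a)
    (U : D) (hU : ∀ u → u E U ↔ M (Σ D λ a → a E A × u E a))
    (X : D) (G : Graph X A U λ a x → x E a) where

    point : ∀ {a x} → a E A → x E a → M (Σ D λ z → z E X × opair z a x)
    point {a} {x} a∈A x∈a k = maps-elim
      (Graph.complete-graph G a∈A (proj₂ (hU x) λ k → k (a , a∈A , x∈a)) x∈a) k

    opair-∈ : ∀ {z a x} → z E X → opair z a x → a E A × x E a
    opair-∈ z∈X o = let a∈A , _ , x∈a = Graph.sound-graph G (maps-intro z∈X o) in a∈A , x∈a

    fib-∈ : ∀ {z a} → z E X → fib z a → a E A
    fib-∈ z∈X h = E-stable λ k → fib-elim h λ (x , o) → k (proj₁ (opair-∈ z∈X o))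

    has-fib : ∀ {z} → z E X → M (Σ D (fib z))
    has-fib z∈X k = Graph.pairs G _ z∈X λ (a , x , _ , _ , o) → k (a , ∃-intro x o)

    FibreList : D → List D → Set
    FibreList a L = length L ≡ suc n × Distinct L × ∀ z → (z E X × fib z a) ↔ z ∈ₗ L

    fibre-list : ∀ {a} → a E A → M (Σ (List D) (FibreList a))
    fibre-list {a} a∈A k = do
      L , eq , h , d ← size-elim {suc n} (sizes a a∈A)
      L′ , eq′ , h′ , d′ ← image L d
      k (L′ , trans eq′ eq , d′ , λ z →
        (λ (z∈X , hz) → ∈ₗ-stable L′ λ k → fib-elim hz λ (x , o) →
          k (proj₂ (h′ z) λ k → k (x , proj₁ (h x) (proj₂ (opair-∈ z∈X o)) , o))) ,
        (λ z∈L′ →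
          E-stable (λ k → proj₁ (h′ z) z∈L′ λ (x , x∈L , o) → point a∈A (proj₂ (h x) x∈L) λ (z′ , z′∈X , o′) →
            k (E-respˡ (opair-unique o′ o) z′∈X)) ,
          stable (Fib 0F 1F) (z ∷ a ∷ []) (λ k → proj₁ (h′ z) z∈L′ λ (x , _ , o) → k (∃-intro x o))))
      where
      image : ∀ L → Distinct L → M (Σ (List D) λ L′ → length L′ ≡ length L ×
        (∀ z → z ∈ₗ L′ ↔ M (Σ D λ x → x ∈ₗ L × opair z a x)) × Distinct L′)
      image [] _ k = k ([] , refl , (λ z → (λ b _ → b) , λ m → m λ (x , b , _) → b) , tt)
      image (x ∷ L) (x∉L , d) k = do
        z , o ← opair-exists a x
        L′ , eq , h , d′ ← image L d
        k (z ∷ L′ , cong suc eq ,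
          (λ u → (λ u∈ k → lem (u Q z) λ
                   { (inj₁ q) → k (x , ∈ₗ-here L Q-refl , opair-resp (Q-sym q) Q-refl Q-refl o)
                   ; (inj₂ m) → proj₁ (h u) (u∈ m) λ (y , y∈L , o′) → k (y , (λ _ → y∈L) , o′) }) ,
                 (λ m u≢z → ∈ₗ-stable L′ λ k → m λ (y , y∈ , o′) → lem (y Q x) λ
                   { (inj₁ q) → u≢z (opair-unique o′ (opair-resp Q-refl Q-refl (Q-sym q) o))
                   ; (inj₂ y≢x) → k (proj₂ (h u) λ k → k (y , y∈ y≢x , o′)) })) ,
          (λ z∈L′ → proj₁ (h z) z∈L′ λ (y , y∈L , o′) → x∉L (∈ₗ-resp L (proj₂ (opair-inj o′ o)) y∈L)) ,
          d′)

    -- The points of a finite X would cover A, each accounting for one member only.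
    infX : Not (fin X)
    infX hX = infA (fin-cover (Fib 1F 0F) []
      (λ z k → lem (Σ D (fib z)) λ
        { (inj₁ (a , h)) → k (a ∷ [] , λ b h′ → ∈ₗ-here [] (fib-unique h′ h))
        ; (inj₂ none) → k ([] , λ b h′ → none (b , h′)) })
      hX λ a a∈A k → fibre-list a∈A λ
        { (z ∷ L , _ , _ , h) → let z∈X , hz = proj₂ (h z) (∈ₗ-here L Q-refl) in k (z , z∈X , hz) })

    ExactlyOne : ∀ {k} → (W a : Fin k) → Formula k
    ExactlyOne W a = ∃∈[ W ] Fib 0F (suc a) ∧ (∀∈[ suc W ] Fib 0F (2 ↑ʳ a) ⇒ 0F ≐ 1F)

    One : D → D → Set
    One W a = ⟦ ExactlyOne 0F 1F ⟧ (W ∷ a ∷ [])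

    one-intro : ∀ {W a z} → z E W → fib z a → (∀ u → u E W → fib u a → u Q z) → One W a
    one-intro {z = z} z∈W hz u = ∃-∧-intro z z∈W (∧-intro hz u)

    one-elim : ∀ {W a} → One W a → M (Σ D λ z → z E W × fib z a × ∀ u → u E W → fib u a → u Q z)
    one-elim h k = ∃-∧-elim h λ (z , z∈W , h′) → ∧-elim h′ λ (hz , u) → k (z , z∈W , hz , u)

    choice : ∀ {W B} → W ⊑ X → (∀ a → a E B → One W a) → ⟦ HasChoiceFunction 0F ⟧ (B ∷ [])
    choice {W} {B} W⊑X one = stable (HasChoiceFunction 0F) (B ∷ []) λ k → do
      f , F ← graph (∃∈[ 2F ] IsOrderedPair 0F 2F 1F) (W ∷ []) B U
      k (∃-intro U (∃-∧-intro f
        (fun-intro (graph-fun F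
          (λ {a} a∈B k → one-elim (one a a∈B) λ (z , z∈W , hz , _) → fib-elim hz λ (x , o) →
            let a∈A , x∈a = opair-∈ (W⊑X z z∈W) o in
            k (x , proj₂ (hU x) (λ k → k (a , a∈A , x∈a)) , ∃-∧-intro z z∈W o))
          (λ {a} {x} {y} a∈B hx hy → Q-stable λ k → do
            _ , _ , _ , u ← one-elim (one a a∈B)
            z , z∈W , o ← ∃-∧-elim hx
            z′ , z′∈W , o′ ← ∃-∧-elim hy
            let same = Q-trans (u z z∈W (∃-intro x o)) (Q-sym (u z′ z′∈W (∃-intro y o′)))
            k (proj₂ (opair-inj (opair-resp same Q-refl Q-refl o) o′)))))
        (λ a a∈B x m → E-stable λ k → ∃-∧-elim (proj₂ (proj₂ (Graph.sound-graph F m))) λ (z , z∈W , o) →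
          k (proj₂ (opair-∈ (W⊑X z z∈W) o)))))

    -- If W₁ and W₂ both single out points of only finitely many members, then Y meets finitely many
    -- members, those in L included, and `fin-cover` makes Y finite. Two sets are allowed because in
    -- (4) the point comes from Y or from its complement.
    select : ∀ {Y W₁ W₂ L} → Y ⊑ X → W₁ ⊑ X → W₂ ⊑ X → Not (fin Y) →
      (∀ {z a} → z E Y → fib z a → a ∉ₗ L → M (One W₁ a ⊎ One W₂ a)) → M (Σ D (Selector A))
    select {Y} {W₁} {W₂} {L} Y⊑X W₁⊑X W₂⊑X infY good k = do
      B₁ , h₁ ← sep (ExactlyOne 1F 0F) (W₁ ∷ []) A
      B₂ , h₂ ← sep (ExactlyOne 1F 0F) (W₂ ∷ []) A
      T , hT ← sep (∃∈[ 1F ] Fib 0F 1F) (Y ∷ []) A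
      l , hl ← list-set L
      V , hV ← binary-union B₁ B₂
      lem (fin B₁) λ
        { (inj₂ inf₁) → k (B₁ , (λ a p → proj₁ (proj₁ (h₁ a) p)) , inf₁ ,
            choice W₁⊑X λ a p → proj₂ (proj₁ (h₁ a) p))
        ; (inj₁ fin₁) → lem (fin B₂) λ
          { (inj₂ inf₂) → k (B₂ , (λ a p → proj₁ (proj₁ (h₂ a) p)) , inf₂ ,
              choice W₂⊑X λ a p → proj₂ (proj₁ (h₂ a) p))
          ; (inj₁ fin₂) → infY (fin-cover (0F ∈ 2F ∧ Fib 0F 1F) (Y ∷ [])
              (λ a k → lem (a E A) λ
                { (inj₁ a∈A) → fibre-list a∈A λ (F , _ , _ , hF) →
                    k (F , λ z h → ∈ₗ-stable F λ k → ∧-elim h λ (z∈Y , hz) → k (proj₁ (hF z) (Y⊑X z z∈Y , hz)))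
                ; (inj₂ a∉A) → k ([] , λ z h → ∧-elim h λ (z∈Y , hz) → a∉A (fib-∈ (Y⊑X z z∈Y) hz)) })
              (fin-union {V} {l} (fin-union fin₁ fin₂ λ a → proj₁ (hV a))
                (fin-list L λ a → proj₁ (hl a)) {T} λ a a∈T a∉V → E-stable λ k → do
                  let a∈A , touched = proj₁ (hT a) a∈T
                  z , z∈Y , hz ← ∃-∧-elim touched
                  good z∈Y hz (λ a∈L → k (proj₂ (hl a) a∈L)) λ
                    { (inj₁ o) → a∉V (proj₂ (hV a) λ n → E-exf (n (proj₂ (h₁ a) (a∈A , o))))
                    ; (inj₂ o) → a∉V (proj₂ (hV a) λ _ → proj₂ (h₂ a) (a∈A , o)) })
              λ z z∈Y k → has-fib (Y⊑X z z∈Y) λ (a , hz) →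
                k (a , proj₂ (hT a) (fib-∈ (Y⊑X z z∈Y) hz , ∃-∧-intro z z∈Y hz) , ∧-intro z∈Y hz)) } }

    -- Transversals with one or two points in each fibre

    data Transversal (Y : D) : List D → List D → Set where
      []  : Transversal Y [] []
      one : ∀ {a as x zs} → x E Y → fib x a → Transversal Y as zs → Transversal Y (a ∷ as) (x ∷ zs)
      two : ∀ {a as x y zs} → x E Y → y E Y → fib x a → fib y a → Not (x Q y) →
        Transversal Y as zs → Transversal Y (a ∷ as) (x ∷ y ∷ zs)

    module _ {Y : D} where

      transversal-⊑ : ∀ {as zs} → Transversal Y as zs → ∀ z → z ∈ₗ zs → z E Y
      transversal-⊑ [] z b = E-exf b
      transversal-⊑ (one x∈Y _ tr) z h = E-stable λ k →
        k (transversal-⊑ tr z (h λ p → k (E-respˡ (Q-sym p) x∈Y)))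
      transversal-⊑ (two x∈Y y∈Y _ _ _ tr) z h = E-stable λ k →
        k (transversal-⊑ tr z (h (λ p → k (E-respˡ (Q-sym p) x∈Y)) (λ p → k (E-respˡ (Q-sym p) y∈Y))))

      transversal-over : ∀ {as zs} → Transversal Y as zs → ∀ {z a} → z ∈ₗ zs → fib z a → a ∈ₗ as
      transversal-over [] h _ = h
      transversal-over (one {as = as} _ hx tr) h hz n =
        transversal-over tr (h λ p → n (fib-unique hz (fib-resp (Q-sym p) Q-refl hx))) hz
      transversal-over (two {as = as} _ _ hx hy _ tr) h hz n = transversal-over tr
        (h (λ p → n (fib-unique hz (fib-resp (Q-sym p) Q-refl hx)))
           (λ p → n (fib-unique hz (fib-resp (Q-sym p) Q-refl hy)))) hz

      transversal-touches : ∀ {as zs} → Transversal Y as zs → ∀ {a} → a ∈ₗ as →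
        M (Σ D λ z → z ∈ₗ zs × fib z a)
      transversal-touches [] h k = h
      transversal-touches (one {a} {x = x} {zs} _ hx tr) {b} h k = lem (b Q a) λ
        { (inj₁ p) → k (x , ∈ₗ-here zs Q-refl , fib-resp Q-refl (Q-sym p) hx)
        ; (inj₂ m) → transversal-touches tr (h m) λ (z , i , hz) → k (z , (λ _ → i) , hz) }
      transversal-touches (two {a} {x = x} {y} {zs} _ _ hx _ _ tr) {b} h k = lem (b Q a) λ
        { (inj₁ p) → k (x , ∈ₗ-here (y ∷ zs) Q-refl , fib-resp Q-refl (Q-sym p) hx)
        ; (inj₂ m) → transversal-touches tr (h m) λ (z , i , hz) → k (z , (λ _ _ → i) , hz) }

      transversal-fresh : ∀ {as zs} → Transversal Y as zs → ∀ {x a} → a ∉ₗ as → fib x a → x ∉ₗ zs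
      transversal-fresh tr a∉ hx h = a∉ (transversal-over tr h hx)

      transversal-thin : ∀ {as zs} → Distinct as → Transversal Y as zs → ∀ a → M (Σ D λ x → Σ D λ y →
        ∀ z → z ∈ₗ zs → fib z a → Not (z Q x) → z Q y)
      transversal-thin d [] a k = k (a , a , λ z h _ _ → Q-exf h)
      transversal-thin (a∉ , d) (one {b} {x = x} _ hx tr) a k = lem (a Q b) λ
        { (inj₁ p) → k (x , x , λ z h hz m → Q-exf
            (transversal-fresh tr a∉ (fib-resp Q-refl p hz) (h m)))
        ; (inj₂ m) → transversal-thin d tr a λ (u , v , f) → k (u , v , λ z h hz →
            f z (h λ p → m (fib-unique hz (fib-resp (Q-sym p) Q-refl hx))) hz) }
      transversal-thin (a∉ , d) (two {b} {x = x} {y} _ _ hx hy _ tr) a k = lem (a Q b) λ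
        { (inj₁ p) → k (x , y , λ z h hz m → Q-stable λ m′ →
            transversal-fresh tr a∉ (fib-resp Q-refl p hz) (h m m′))
        ; (inj₂ m) → transversal-thin d tr a λ (u , v , f) → k (u , v , λ z h hz →
            f z (h (λ p → m (fib-unique hz (fib-resp (Q-sym p) Q-refl hx)))
                   (λ p → m (fib-unique hz (fib-resp (Q-sym p) Q-refl hy)))) hz) }

      transversal-distinct : ∀ {as zs} → Distinct as → Transversal Y as zs → Distinct zs
      transversal-distinct d [] = tt
      transversal-distinct (a∉ , d) (one _ hx tr) = transversal-fresh tr a∉ hx , transversal-distinct d tr
      transversal-distinct (a∉ , d) (two _ _ hx hy x≢y tr) =
        (λ h → transversal-fresh tr a∉ hx (h x≢y)) , transversal-fresh tr a∉ hy , transversal-distinct d tr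

      transversal-spec : ∀ {as zs s σ} → Distinct as → Transversal Y as zs → zs lists s → as lists σ → spec s σ
      transversal-spec d tr hs hσ = ∧-intro
        (thin-intro λ a k → transversal-thin d tr a λ (x , y , f) → k (x , y , λ z p → f z (proj₁ (hs z) p)))
        (support-intro λ a →
          (λ p k → transversal-touches tr (proj₁ (hσ a) p) λ (z , i , hz) → k (z , proj₂ (hs z) i , hz)) ,
          (λ m → E-stable λ k → m λ (z , z∈s , hz) →
            k (proj₂ (hσ a) (transversal-over tr (proj₁ (hs z) z∈s) hz))))

    -- Bounding the color classes

    record Decomposition (as : List D) (Fs : List (List D)) (t : D) : Set where
      field
        p q      : ℕ
        zs       : List D
        selected : zs ∈ᴸ selections p q Fs
        distinct : Distinct zs
        listing  : zs lists t
        size-zs  : length zs ≡ p + p + q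
        size-as  : p + q ≡ length as

    FibreLists : List D → Set
    FibreLists = All (λ a → Σ (List D) (FibreList a))

    -- The points of t over the first member are split off: at least one by `touches`, at most two
    -- by `thin`. They are replaced by literal entries of the fibre list, so that the result lands
    -- in `selections`, and p and q record which case occurred.
    decompose : ∀ {as} (Fs : FibreLists as) → Distinct as → ∀ t → t ⊑ X →
      (∀ {z a} → z E t → fib z a → a ∈ₗ as) →
      (∀ a → a ∈ₗ as → M (Σ D λ z → z E t × fib z a)) →
      (∀ a → M (Σ D λ x → Σ D λ y → ∀ z → z E t → fib z a → Not (z Q x) → z Q y)) →
      M (Decomposition as (reduce proj₁ Fs) t)
    decompose [] _ t t⊑X over touches thin k = k record
      { p = 0 ; q = 0 ; zs = [] ; selected = here refl ; distinct = tt ; size-zs = refl ; size-as = refl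
      ; listing = λ z → (λ z∈t → has-fib (t⊑X z z∈t) λ (a , hz) → over z∈t hz) , E-exf }
    decompose {a ∷ as} ((F , hF) ∷ Fs) (a∉ , d) t t⊑X over touches thin k = do
      t′ , ht′ ← sep (¬′ Fib 0F 1F) (a ∷ []) t
      rec ← decompose Fs d t′
        (λ z p → t⊑X z (proj₁ (proj₁ (ht′ z) p)))
        (λ {z} p hz → let z∈t , ¬fib = proj₁ (ht′ z) p in
          over z∈t hz λ q → ¬fib (fib-resp Q-refl q hz))
        (λ b b∈ k → touches b (λ _ → b∈) λ (z , z∈t , hz) → k (z , proj₂ (ht′ z) (z∈t ,
          λ hz′ → a∉ (∈ₗ-resp as (fib-unique hz hz′) b∈)) , hz))
        (λ b k → thin b λ (x , y , f) → k (x , y , λ z p → f z (proj₁ (proj₁ (ht′ z) p))))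
      let open Decomposition rec
          in-F : ∀ {z} → z E t → fib z a → z ∈ₗ F
          in-F z∈t hz = proj₁ (proj₂ (proj₂ hF) _) (t⊑X _ z∈t , hz)
          rest : ∀ {z} → z E t → Not (fib z a) → z ∈ₗ zs
          rest z∈t m = proj₁ (listing _) (proj₂ (ht′ _) (z∈t , m))
          zs-t : ∀ {z} → z ∈ₗ zs → z E t
          zs-t i = proj₁ (proj₁ (ht′ _) (proj₂ (listing _) i))
          zs-¬ : ∀ {z} → z ∈ₗ zs → Not (fib z a)
          zs-¬ i = proj₂ (proj₁ (ht′ _) (proj₂ (listing _) i))
      z₀ , z₀∈t , hz₀ ← touches a (∈ₗ-here as Q-refl)
      x , y , f ← thin a
      lem (Σ D λ z₁ → z₁ E t × fib z₁ a × Not (z₀ Q z₁)) λ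
        { (inj₂ none) → do
            u , u∈F , z₀≐u ← ∈ₗ-literal F (in-F z₀∈t hz₀)
            let hu = fib-resp z₀≐u Q-refl hz₀
                u∈t = E-respˡ z₀≐u z₀∈t
            k record
              { p = p ; q = suc q ; zs = u ∷ zs
              ; selected = single-∈ p q u∈F selected
              ; distinct = (λ i → zs-¬ i hu) , distinct
              ; listing = λ z →
                  (λ z∈t z≢u → ∈ₗ-stable zs λ k → lem (fib z a) λ
                    { (inj₁ hz) → none (z , z∈t , hz , λ e → z≢u (Q-trans (Q-sym e) z₀≐u))
                    ; (inj₂ m) → k (rest z∈t m) }) ,
                  (λ h → E-stable λ k → k (zs-t (h λ e → k (E-respˡ (Q-sym e) u∈t))))
              ; size-zs = trans (cong suc size-zs) (sym (+-suc (p + p) q))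
              ; size-as = trans (+-suc p q) (cong suc size-as)
              }
        ; (inj₁ (z₁ , z₁∈t , hz₁ , z₀≢z₁)) → do
            u , v , uv∈ , e ← twoSubsets-literal F (in-F z₀∈t hz₀) (in-F z₁∈t hz₁) z₀≢z₁
            let PairIn : D → D → Set
                PairIn u v = u E t × v E t × fib u a × fib v a × Not (u Q v)
                pair-in : (z₀ Q u × z₁ Q v) ⊎ (z₀ Q v × z₁ Q u) → PairIn u v
                pair-in = λ
                  { (inj₁ (e₀ , e₁)) → E-respˡ e₀ z₀∈t , E-respˡ e₁ z₁∈t , fib-resp e₀ Q-refl hz₀ ,
                      fib-resp e₁ Q-refl hz₁ , λ e → z₀≢z₁ (Q-trans e₀ (Q-trans e (Q-sym e₁)))
                  ; (inj₂ (e₀ , e₁)) → E-respˡ e₁ z₁∈t , E-respˡ e₀ z₀∈t , fib-resp e₁ Q-refl hz₁ ,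
                      fib-resp e₀ Q-refl hz₀ , λ e → z₀≢z₁ (Q-trans e₀ (Q-trans (Q-sym e) (Q-sym e₁))) }
                u∈t , v∈t , hu , hv , u≢v = pair-in e
                covered : ∀ z → z E t → fib z a → z ∈ₗ x ∷ y ∷ []
                covered z z∈t hz m m′ = m′ (f z z∈t hz m)
            k record
              { p = suc p ; q = q ; zs = u ∷ v ∷ zs
              ; selected = double-∈ p q uv∈ selected
              ; distinct = (λ i → zs-¬ (i u≢v) hu) , (λ i → zs-¬ i hv) , distinct
              ; listing = λ z →
                  (λ z∈t z≢u z≢v → ∈ₗ-stable zs λ k → lem (fib z a) λ
                    -- Otherwise z, u and v would be three distinct points covered by x and y.
                    { (inj₁ hz) → pigeonhole (z ∷ u ∷ v ∷ []) (x ∷ y ∷ [])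
                        ((λ i → i z≢u z≢v) , (λ i → i u≢v) , (λ b → b) , tt)
                        (λ w i → ∈ₗ-stable (x ∷ y ∷ []) λ k → i
                          (λ e → k (∈ₗ-resp (x ∷ y ∷ []) (Q-sym e) (covered z z∈t hz)))
                          (λ e → k (∈ₗ-resp (x ∷ y ∷ []) (Q-sym e) (covered u u∈t hu)))
                          (λ e → k (∈ₗ-resp (x ∷ y ∷ []) (Q-sym e) (covered v v∈t hv))))
                        λ { (s≤s (s≤s ())) }
                    ; (inj₂ m) → k (rest z∈t m) }) ,
                  (λ h → E-stable λ k → k (zs-t
                    (h (λ e → k (E-respˡ (Q-sym e) u∈t)) (λ e → k (E-respˡ (Q-sym e) v∈t)))))
              ; size-zs = trans (cong (λ i → suc (suc i)) size-zs) (cong (λ i → suc (i + q)) (sym (+-suc p p)))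
              ; size-as = cong suc size-as
              } }

    fibre-lists : ∀ {σ} as → (∀ a → a ∈ₗ as → a E σ) → σ ⊑ A → M (FibreLists as)
    fibre-lists []       h σ⊑A k = k []
    fibre-lists (a ∷ as) h σ⊑A k = do
      Fs ← fibre-lists as (λ b b∈ → h b λ _ → b∈) σ⊑A
      F ← fibre-list (σ⊑A a (h a (∈ₗ-here as Q-refl)))
      k (F ∷ Fs)

    fibre-lengths : ∀ {as} (Fs : FibreLists as) → All (λ F → length F ≡ suc n) (reduce proj₁ Fs)
    fibre-lengths []                   = []
    fibre-lengths ((F , eq , _) ∷ Fs) = eq ∷ fibre-lengths Fs

    module _ (p q r : ℕ) (1≤r : 1 ≤ r) (bound : ((p + q) C p) * (suc n C 2) ^ p * suc n ^ q ≤ r) where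

      private
        m = p + p + q

      specials : ∀ {σ} → σ ⊑ A → size (p + q) σ → M (Σ (List D) λ L → length L ≤ r ×
        ∀ t → t ∈[ X ^ m ] → spec t σ → t ∈ₗ L)
      specials {σ} σ⊑A hσ k = do
        as , eqₐ , has , d ← size-elim {p + q} hσ
        Fs ← fibre-lists as (λ a → proj₂ (has a)) σ⊑A
        L , eqₗ , h ← list-sets (selections p q (reduce proj₁ Fs))
        k (L , ≤-trans (≤-reflexive eqₗ) (≤-trans (length-selections p q (fibre-lengths Fs)) bound) ,
          λ t (t⊑X , ht) st → ∈ₗ-stable L λ k → do
            dec ← decompose Fs d t t⊑X
              (λ {z} {a} z∈t hz → proj₁ (has a) (proj₂ (spec-support st a) λ k → k (z , z∈t , hz)))
              (λ a a∈ → proj₁ (spec-support st a) (proj₂ (has a) a∈))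
              (thin-elim (spec-thin st))
            zs , eq , hzs , dzs ← size-elim {m} ht
            let module Dec = Decomposition dec
            le ← pigeonhole zs Dec.zs dzs λ z i → proj₁ (Dec.listing z) (proj₂ (hzs z) i)
            ge ← pigeonhole Dec.zs zs Dec.distinct λ z i → proj₁ (hzs z) (proj₂ (Dec.listing z) i)
            -- Both lists enumerate t, so the counts p′ and q′ of the decomposition satisfy 2p′ + q′
            -- = 2p + q. Together with p′ + q′ = p + q this forces p′ = p and q′ = q.
            let sizes-agree : Dec.p + (Dec.p + Dec.q) ≡ p + (p + q)
                sizes-agree = trans (sym (+-assoc Dec.p Dec.p Dec.q)) (trans (sym Dec.size-zs)
                  (trans (≤-antisym ge le) (trans eq (+-assoc p p q))))
                tops : Dec.p + Dec.q ≡ p + q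
                tops = trans Dec.size-as eqₐ
                p≡ : Dec.p ≡ p
                p≡ = +-cancelʳ-≡ (p + q) Dec.p p (trans (cong (Dec.p +_) (sym tops)) sizes-agree)
                q≡ : Dec.q ≡ q
                q≡ = +-cancelˡ-≡ p Dec.q q (trans (cong (_+ Dec.q) (sym p≡)) tops)
            k (h (subst (λ i → Dec.zs ∈ᴸ selections i q (reduce proj₁ Fs)) p≡
                   (subst (λ i → Dec.zs ∈ᴸ selections Dec.p i (reduce proj₁ Fs)) q≡ Dec.selected)) Dec.listing))

      same-support-bounded : ∀ s → s ∈[ X ^ m ] → M (Σ (List D) λ L → length L ≤ r ×
        ∀ t → t ∈[ X ^ m ] → Rel (SameSupport (p + q)) [] s t → t ∈ₗ L)
      same-support-bounded s hs k = lem (Σ D λ σ → size (p + q) σ × spec s σ) λ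
        { (inj₁ (σ , hσ , sσ)) → do
            L , le , h ← specials
              (λ a a∈σ → E-stable λ k → proj₁ (spec-support sσ a) a∈σ λ (z , z∈s , hz) →
                k (fib-∈ (proj₁ hs z z∈s) hz)) hσ
            k (L , le , λ t ht rel → ∈ₗ-stable L λ k → same-elim {p + q} rel λ
              { (inj₁ s≐t) → k (h t ht (spec-resp s≐t Q-refl sσ))
              ; (inj₂ (τ , _ , sτ , tτ)) → k (h t ht (spec-resp Q-refl (support-unique sτ sσ) tτ)) })
        -- Without a support of size p + q the class is {s}; here 1 ≤ r enters.
        ; (inj₂ none) → k (s ∷ [] , 1≤r , λ t ht rel m → same-elim {p + q} rel λ
              { (inj₁ s≐t) → m (Q-sym s≐t)
              ; (inj₂ (σ , hσ , sσ , _)) → none (σ , hσ , sσ) }) }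

      -- Two transversals of m points over the same p + q members have the same class, so inside the
      -- polychromatic Y they are one set. Only the transfer of a point is recorded, ready to be
      -- contradicted by an exchange.
      rigid-set : ⟦ RRT m r ⟧ [] → M (Σ D λ Y → Y ⊑ X × Not (fin Y) ×
        (∀ {as zs zs′ x} → length as ≡ p + q → Distinct as → length zs ≡ m → length zs′ ≡ m →
          Transversal Y as zs → Transversal Y as zs′ → x ∈ₗ zs → x ∈ₗ zs′))
      rigid-set rrt k = do
        Y , Y⊑X , infY , poly ← rainbow m r rrt (SameSupport (p + q)) [] infX infA
          (λ s _ → same-refl {p + q} s) same-support-bounded
        k (Y , Y⊑X , infY , λ {as} {zs} {zs′} {x} eqₐ d eq eq′ tr tr′ x∈ → ∈ₗ-stable zs′ λ k → do
          σ , hσ ← list-set as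
          s , hs ← list-set zs
          t , ht ← list-set zs′
          let sized : size (p + q) σ
              sized = subst (λ i → size i σ) eqₐ (size-intro as hσ d)
              sσ = transversal-spec d tr hs hσ
              tσ = transversal-spec d tr′ ht hσ
              s≐t : s Q t
              s≐t = poly s t
                ((λ z i → transversal-⊑ tr z (proj₁ (hs z) i)) ,
                 subst (λ i → size i s) eq (size-intro zs hs (transversal-distinct d tr)))
                ((λ z i → transversal-⊑ tr′ z (proj₁ (ht z) i)) ,
                 subst (λ i → size i t) eq′ (size-intro zs′ ht (transversal-distinct d tr′)))
                (λ u _ → same-class {p + q} sized sσ tσ u , same-class {p + q} sized tσ sσ u)
          k (proj₁ (ht x) (E-respʳ s≐t (proj₂ (hs x) x∈))))

    -- Selectors from doubly met members

    record Double (Y a : D) : Set where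
      constructor double
      field
        {x y} : D
        x∈Y   : x E Y
        y∈Y   : y E Y
        fib-x : fib x a
        fib-y : fib y a
        x≢y   : Not (x Q y)

    -- If fewer than N members are met twice, they fit into a finite list, and outside it Y itself
    -- singles out a point.
    select-singles : ∀ {Y} N → Y ⊑ X → Not (fin Y) →
      (∀ {as} → length as ≡ N → Distinct as → All (Double Y) as → Bot) → M (Σ D (Selector A))
    select-singles {Y} N Y⊑X infY none k = do
      L , h ← exhaust (Double Y) N none
      select {Y} {Y} {Y} {L} Y⊑X Y⊑X Y⊑X infY (λ {z} {a} z∈Y hz a∉L k → k (inj₁ (one-intro z∈Y hz
        λ u u∈Y hu → Q-stable λ u≢z → a∉L (h a (double u∈Y z∈Y hu hz u≢z))))) k

    pick : ∀ {Y as} → ℕ → All (Double Y) as → List D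
    pick i       []                    = []
    pick zero    (double {x} _ _ _ _ _ ∷ ds) = x ∷ pick zero ds
    pick (suc i) (double {x} {y} _ _ _ _ _ ∷ ds) = x ∷ y ∷ pick i ds

    pick-transversal : ∀ {Y as} i (ds : All (Double Y) as) → Transversal Y as (pick i ds)
    pick-transversal i       []                        = []
    pick-transversal zero    (double p _ f _ _ ∷ ds)   = one p f (pick-transversal zero ds)
    pick-transversal (suc i) (double p q f g m ∷ ds)   = two p q f g m (pick-transversal i ds)

    length-pick : ∀ {Y as} i (ds : All (Double Y) as) j → length as ≡ i + j →
      length (pick i ds) ≡ i + i + j
    length-pick zero    []                  zero    eq = refl
    length-pick zero    (double _ _ _ _ _ ∷ ds) (suc j) eq = cong suc (length-pick zero ds j (suc-injective eq))
    length-pick (suc i) (double _ _ _ _ _ ∷ ds) j       eq = trans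
      (cong (λ i → suc (suc i)) (length-pick i ds j (suc-injective eq))) (cong (λ l → suc (l + j)) (sym (+-suc i i)))

    -- Over the first of p + q + 1 doubly met members take x or y alone, and the same points over
    -- the rest: two transversals, the second of which misses x. The exchanged point needs a single
    -- fibre, hence `suc q`.
    selector-pq : ∀ p q r → 1 ≤ r → ((p + suc q) C p) * (suc n C 2) ^ p * suc n ^ suc q ≤ r →
      ⟦ RRT (p + p + suc q) r ⟧ [] → M (Σ D (Selector A))
    selector-pq p q r 1≤r bound rrt k = do
      Y , Y⊑X , infY , rigid ← rigid-set p (suc q) r 1≤r bound rrt
      select-singles (p + suc q) Y⊑X infY
        (λ { {[]} eq _ _ → absurd (trans eq (+-suc p q))
           ; {a ∷ as} eq d@(a∉ , _) (double {x} {y} x∈Y y∈Y hx hy x≢y ∷ ds) →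
               let tr = pick-transversal p ds
                   len : suc (length (pick p ds)) ≡ p + p + suc q
                   len = trans (cong suc (length-pick p ds q (suc-injective (trans eq (+-suc p q)))))
                           (sym (+-suc (p + p) q))
               in transversal-fresh tr a∉ hx
                    (rigid {zs = x ∷ pick p ds} {y ∷ pick p ds} eq d len len
                      (one x∈Y hx tr) (one y∈Y hy tr) (∈ₗ-here (pick p ds) Q-refl) x≢y) })
        k
      where
      absurd : ∀ {i} → 0 ≡ suc i → Bot
      absurd ()

    -- The bound is 3 because a fibre of three points contains C(3, 2) pairs. A member met by Y in
    -- two points has its third point in the complement W, so one of Y and W meets it exactly once.
    selector-three : n ≡ 2 → ⟦ RRT 2 3 ⟧ [] → M (Σ D (Selector A))
    selector-three n≡2 rrt k = do
      Y , Y⊑X , infY , rigid ← rigid-set 1 0 3 (s≤s z≤n)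
        (subst (λ i → (1 C 1) * (suc i C 2) ^ 1 * suc i ^ 0 ≤ 3) (sym n≡2) ≤-refl) rrt
      W , hW ← sep (¬′ (0F ∈ 1F)) (Y ∷ []) X
      select {Y} {Y} {W} {[]} Y⊑X Y⊑X (λ z p → proj₁ (proj₁ (hW z) p)) infY
        (λ {z} {a} z∈Y hz _ k → lem (Σ D λ u → u E Y × fib u a × Not (u Q z)) λ
          { (inj₂ none) → k (inj₁ (one-intro z∈Y hz λ u u∈Y hu → Q-stable λ u≢z → none (u , u∈Y , hu , u≢z)))
          ; (inj₁ (u , u∈Y , hu , u≢z)) → do
              F , eq , d , hF ← fibre-list (fib-∈ (Y⊑X z z∈Y) hz)
              let eq₃ = trans eq (cong suc n≡2)
              lem (Σ D λ w → w ∈ₗ F × Not (w Q u) × Not (w Q z)) λ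
                { (inj₂ none) → pigeonhole F (u ∷ z ∷ []) d
                    (λ w i w≢u w≢z → none (w , i , w≢u , w≢z))
                    λ le → too-many (subst (_≤ 2) eq₃ le)
                ; (inj₁ (w , w∈F , w≢u , w≢z)) →
                    let w∈X , hw = proj₂ (hF w) w∈F
                        -- Otherwise {u , z} and {w , z} would be two pairs of Y over the same
                        -- member.
                        w∉Y : Not (w E Y)
                        w∉Y w∈Y = rigid {a ∷ []} {u ∷ z ∷ []} {w ∷ z ∷ []} {u} refl ((λ b → b) , tt) refl refl
                          (two u∈Y z∈Y hu hz u≢z []) (two w∈Y z∈Y hw hz w≢z [])
                          (∈ₗ-here (z ∷ []) Q-refl) (λ e → w≢u (Q-sym e)) u≢z
                    in k (inj₂ (one-intro (proj₂ (hW w) (w∈X , w∉Y)) hw λ v v∈W hv → Q-stable λ v≢w →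
                      let v∈X , v∉Y = proj₁ (hW v) v∈W in
                      pigeonhole (v ∷ w ∷ u ∷ z ∷ []) F
                        ((λ i → i v≢w (λ e → v∉Y (E-respˡ (Q-sym e) u∈Y)) (λ e → v∉Y (E-respˡ (Q-sym e) z∈Y))) ,
                         (λ i → i w≢u w≢z) , (λ i → i u≢z) , (λ b → b) , tt)
                        (λ y i → ∈ₗ-stable F λ k → i
                          (λ e → k (∈ₗ-resp F (Q-sym e) (proj₁ (hF v) (v∈X , hv))))
                          (λ e → k (∈ₗ-resp F (Q-sym e) w∈F))
                          (λ e → k (∈ₗ-resp F (Q-sym e) (proj₁ (hF u) (Y⊑X u u∈Y , hu))))
                          (λ e → k (∈ₗ-resp F (Q-sym e) (proj₁ (hF z) (Y⊑X z z∈Y , hz)))))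
                        λ le → too-many′ (subst (4 ≤_) eq₃ le))) } }) k
      where
      too-many : 3 ≤ 2 → Bot
      too-many (s≤s (s≤s ()))
      too-many′ : 4 ≤ 3 → Bot
      too-many′ (s≤s (s≤s (s≤s ())))

    -- Exchanging partners in two-element fibres

    data Matching (Y : D) : List D → List D → List D → Set where
      []    : Matching Y [] [] []
      match : ∀ {a as x xs y ys} → x E Y → y E Y → fib x a → fib y a → Not (x Q y) →
        Matching Y as xs ys → Matching Y (a ∷ as) (x ∷ xs) (y ∷ ys)

    module _ {Y : D} where

      matching-sym : ∀ {as xs ys} → Matching Y as xs ys → Matching Y as ys xs
      matching-sym []                       = []
      matching-sym (match p q hx hy x≢y mt) = match q p hy hx (λ e → x≢y (Q-sym e)) (matching-sym mt)

      matching-transversal : ∀ {as xs ys} → Matching Y as xs ys → Transversal Y as xs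
      matching-transversal []                     = []
      matching-transversal (match p _ hx _ _ mt) = one p hx (matching-transversal mt)

      matching-length : ∀ {as xs ys} → Matching Y as xs ys → length xs ≡ length as
      matching-length []                    = refl
      matching-length (match _ _ _ _ _ mt) = cong suc (matching-length mt)

      doubles-matching : ∀ {as} → All (Double Y) as → Σ (List D) λ xs → Σ (List D) λ ys → Matching Y as xs ys
      doubles-matching [] = [] , [] , []
      doubles-matching (double {x} {y} p q hx hy x≢y ∷ ds) =
        let xs , ys , mt = doubles-matching ds in x ∷ xs , y ∷ ys , match p q hx hy x≢y mt

      matching-disjoint : ∀ {as xs ys} → Distinct as → Matching Y as xs ys → ∀ {z} → z ∈ₗ xs → z ∉ₗ ys
      matching-disjoint _ [] h _ = h
      matching-disjoint (a∉ , d) (match {x = x} {y = y} {ys} _ _ hx hy x≢y mt) {z} h h′ = lem (z Q x) λ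
        { (inj₁ z≐x) → transversal-fresh (matching-transversal (matching-sym mt)) a∉
            (fib-resp (Q-sym z≐x) Q-refl hx) (h′ λ z≐y → x≢y (Q-trans (Q-sym z≐x) z≐y))
        ; (inj₂ z≢x) → lem (z Q y) λ
          { (inj₁ z≐y) → transversal-fresh (matching-transversal mt) a∉
              (fib-resp (Q-sym z≐y) Q-refl hy) (h z≢x)
          ; (inj₂ z≢y) → matching-disjoint d mt (h z≢x) (h′ z≢y) } }

      matching-partner : ∀ {as xs ys} → Matching Y as xs ys → ∀ {z} → z ∈ₗ ys →
        M (Σ D λ w → Σ D λ a → w ∈ₗ xs × Not (w Q z) × fib w a × fib z a)
      matching-partner [] h k = h
      matching-partner (match {a} {x = x} {xs} {y} _ _ hx hy x≢y mt) {z} h k = lem (z Q y) λ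
        { (inj₁ p) → k (x , a , ∈ₗ-here xs Q-refl , (λ q → x≢y (Q-trans q p)) , hx , fib-resp (Q-sym p) Q-refl hy)
        ; (inj₂ m) → matching-partner mt (h m) λ (w , b , i , rest) → k (w , b , (λ _ → i) , rest) }

      -- A point that shares a fibre with x and differs from x must be y, for otherwise z, x and y
      -- would be three points in a fibre of two.
      partner-matching : n ≡ 1 → Y ⊑ X → ∀ {as xs ys} → Matching Y as xs ys → ∀ {w z a} →
        w ∈ₗ xs → Not (w Q z) → fib w a → fib z a → z E X → z ∈ₗ ys
      partner-matching n≡1 Y⊑X [] h _ _ _ _ = h
      partner-matching n≡1 Y⊑X (match {b} {x = x} {y = y} {ys} x∈Y y∈Y hx hy x≢y mt)
        {w} {z} {a} h w≢z hw hz z∈X z≢y =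
        ∈ₗ-stable ys λ k → lem (w Q x) λ
          { (inj₂ w≢x) → k (partner-matching n≡1 Y⊑X mt (h w≢x) w≢z hw hz z∈X)
          ; (inj₁ w≐x) → do
              F , eq , _ , hF ← fibre-list (fib-∈ (Y⊑X x x∈Y) hx)
              let hz′ = fib-resp Q-refl (fib-unique (fib-resp w≐x Q-refl hw) hx) hz
              pigeonhole (z ∷ x ∷ y ∷ []) F
                ((λ i → i (λ e → w≢z (Q-trans w≐x (Q-sym e))) z≢y) , (λ i → i x≢y) , (λ b → b) , tt)
                (λ v i → ∈ₗ-stable F λ k → i
                  (λ e → k (∈ₗ-resp F (Q-sym e) (proj₁ (hF z) (z∈X , hz′))))
                  (λ e → k (∈ₗ-resp F (Q-sym e) (proj₁ (hF x) (Y⊑X x x∈Y , hx))))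
                  (λ e → k (∈ₗ-resp F (Q-sym e) (proj₁ (hF y) (Y⊑X y y∈Y , hy)))))
                λ le → too-many (subst (3 ≤_) (trans eq (cong suc n≡1)) le) }
        where
        too-many : 3 ≤ 2 → Bot
        too-many (s≤s (s≤s ()))

      matching-flips : n ≡ 1 → Y ⊑ X → ∀ {as xs ys s t} → Matching Y as xs ys →
        xs lists s → ys lists t → flips X s t
      matching-flips n≡1 Y⊑X mt hs ht = flips-intro λ z z∈X →
        (λ p k → matching-partner mt (proj₁ (ht z) p)
          λ (w , a , i , rest) → k (w , a , proj₂ (hs w) i , rest)) ,
        (λ m → E-stable λ k → m λ (w , a , w∈s , w≢z , hw , hz) →
          k (proj₂ (ht z) (partner-matching n≡1 Y⊑X mt (proj₁ (hs w) w∈s) w≢z hw hz z∈X)))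

    -- Since s and t are each other's sets of partners, both classes consist of s and t.
    flipped-class : ∀ {s t} → s ⊑ X → t ⊑ X → flips X s t → flips X t s → ∀ u → u ⊑ X →
      Rel EqualOrFlipped (X ∷ []) s u → Rel EqualOrFlipped (X ∷ []) t u
    flipped-class {s} {t} s⊑X t⊑X st ts u u⊑X h = stable EqualOrFlipped (u ∷ t ∷ X ∷ []) λ k → ∨-elim h λ
      { (inj₁ s≐u) → k λ _ → resp (Flip 0F 1F 2F) (Q-refl ∷ s≐u ∷ Q-refl ∷ []) ts
      ; (inj₂ su) → k λ m → exf (Flip 0F 1F 2F) (t ∷ u ∷ X ∷ []) (m (flips-unique t⊑X u⊑X st su)) }

    selector-two : n ≡ 1 → ∀ m r → 2 ≤ r → ⟦ RRT (suc m) r ⟧ [] → M (Σ D (Selector A))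
    selector-two n≡1 m r 2≤r rrt k = do
      Y , Y⊑X , infY , poly ← rainbow (suc m) r rrt EqualOrFlipped (X ∷ []) infX infA
        (λ s _ n → exf (Flip 0F 1F 2F) (s ∷ s ∷ X ∷ []) (n Q-refl))
        -- The class is covered by s and its set of partners s′, hence 2 ≤ r.
        (λ s _ k → do
          s′ , hs′ ← sep (Partner 0F 1F) (s ∷ []) X
          k (s ∷ s′ ∷ [] , 2≤r , λ t (t⊑X , _) rel t≢s t≢s′ → t≢s′ (flips-unique t⊑X
            (λ z p → proj₁ (proj₁ (hs′ z) p)) (rel λ e → t≢s (Q-sym e))
            (flips-intro λ z z∈X → (λ p → proj₁ partner (proj₂ (proj₁ (hs′ z) p))) ,
              (λ q → proj₂ (hs′ z) (z∈X , proj₂ partner q))))))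
      select-singles (suc m) Y⊑X infY
        (λ { {a ∷ as} eq d ds@(double {x} x∈Y _ hx _ _ ∷ _) →
          let xs , ys , mt = doubles-matching ds
              mt′ = matching-sym mt
              tr  = matching-transversal mt
              tr′ = matching-transversal mt′
              eq₁ = trans (matching-length mt) eq
              eq₂ = trans (matching-length mt′) eq
          in do
            s , hs ← list-set xs
            t , ht ← list-set ys
            -- A point of s is enough for the contradiction: s and t are disjoint, yet the coloring
            -- makes them equal.
            z , z∈xs , _ ← transversal-touches tr (∈ₗ-here as Q-refl)
            let s⊑Y = λ z i → transversal-⊑ tr z (proj₁ (hs z) i)
                t⊑Y = λ z i → transversal-⊑ tr′ z (proj₁ (ht z) i)
                s⊑X = λ z i → Y⊑X z (s⊑Y z i)
                t⊑X = λ z i → Y⊑X z (t⊑Y z i)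
                st = matching-flips n≡1 Y⊑X mt hs ht
                ts = matching-flips n≡1 Y⊑X mt′ ht hs
                s≐t = poly s t
                  (s⊑Y , subst (λ i → size i s) eq₁ (size-intro xs hs (transversal-distinct d tr)))
                  (t⊑Y , subst (λ i → size i t) eq₂ (size-intro ys ht (transversal-distinct d tr′)))
                  (λ u hu → flipped-class s⊑X t⊑X st ts u (proj₁ hu) , flipped-class t⊑X s⊑X ts st u (proj₁ hu))
            matching-disjoint d mt z∈xs (proj₁ (ht z) (E-respʳ s≐t (proj₂ (hs z) z∈xs))) })
        k

  -- From models back to derivations in ZF

  choice-principle : ∀ n →
    (∀ A (infA : Not (fin A)) (sizes : ∀ a → a E A → size (suc n) a)
      U (hU : ∀ u → u E U ↔ M (Σ D λ a → a E A × u E a))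
      X (G : Graph X A U λ a x → x E a) → M (Σ D (Selector A))) →
    ⟦ AC⁻ (suc n) ⟧ []
  choice-principle n sel A infA sizes k = do
    U , hU ← union-set A
    X , G ← graph (0F ∈ 1F) [] A U
    B , B⊑A , infB , ch ← sel A infA (λ a a∈A → proj₁ (size-at (suc n) (a ∷ A ∷ []) 0F) (sizes a a∈A)) U hU X G
    k B (∧-intro B⊑A (∧-intro infB ch))

-- The axiom of infinity serves as the existential theorem that makes the domain nonempty.
entailment : (φ ψ : Sentence) →
  (∀ 𝔐 (sound : Sound ZF 𝔐) → Structure.⟦_⟧ 𝔐 φ [] → Structure.⟦_⟧ 𝔐 ψ []) → ZF ⊢ (φ ⇒ ψ)
entailment φ ψ h = completeness (axiom infinity) (φ ⇒ ψ) h

[k+i]Ck≡[k+i]Ci : ∀ k i → (k + i) C k ≡ (k + i) C i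
[k+i]Ck≡[k+i]Ci k i = trans (nCk≡nC[n∸k] (m≤m+n k i)) (cong ((k + i) C_) (m+n∸m≡n k i))

1≤[k+i]Ci : ∀ k i → 1 ≤ (k + i) C i
1≤[k+i]Ci k zero    = ≤-reflexive (sym (trans (sym ([k+i]Ck≡[k+i]Ci k 0))
  (trans (cong (_C k) (+-identityʳ k)) (nCn≡1 k))))
1≤[k+i]Ci k (suc i) = begin
  1                                 ≤⟨ 1≤[k+i]Ci k i ⟩
  (k + i) C i                       ≤⟨ m≤m+n _ _ ⟩
  (k + i) C i + (k + i) C suc i     ≡⟨ nCk+nC[k+1]≡[n+1]C[k+1] (k + i) i ⟩
  suc (k + i) C suc i               ≡⟨ cong (_C suc i) (+-suc k i) ⟨
  (k + suc i) C suc i               ∎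
  where open ≤-Reasoning

-- (2) and (3) are the cases q = 0 and q = 1.
RRT⇒AC⁻ : ∀ n p q r →
  ((p + suc q) C suc q) * (suc (suc n) C 2) ^ p * suc (suc n) ^ suc q ≤ r →
  ZF ⊢ (RRT (p + p + suc q) r ⇒ AC⁻ (suc (suc n)))
RRT⇒AC⁻ n p q r bound = entailment _ _ λ 𝔐 sound rrt →
  let open Model 𝔐 sound in
  choice-principle (suc n) λ A infA sizes U hU X G →
    Family.selector-pq (suc n) A infA sizes U hU X G p q r
      (≤-trans positive bound) (subst (λ c → c * _ * _ ≤ r) (sym ([k+i]Ck≡[k+i]Ci p (suc q))) bound) rrt
  where
  -- Singleton classes require 1 ≤ r, which follows from the given bound because each of its factors
  -- is positive.
  positive : 1 ≤ ((p + suc q) C suc q) * (suc (suc n) C 2) ^ p * suc (suc n) ^ suc q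
  positive = *-mono-≤ (*-mono-≤ (1≤[k+i]Ci p (suc q))
    (m^n>0 (suc (suc n) C 2) {{>-nonZero (subst (λ i → 1 ≤ i C 2) (+-comm n 2) (1≤[k+i]Ci n 2))}} p))
    (m^n>0 (suc (suc n)) (suc q))

proposition3p3 : (m n k : ℕ) → 2 ≤ m → 2 ≤ n → 1 ≤ k →
    (ZF ⊢ (RRT m n ⇒ AC⁻ 2))
    × ((r : ℕ) → (n C 2) ^ k * n * (k + 1) ≤ r → ZF ⊢ (RRT (2 * k + 1) r ⇒ AC⁻ n))
    × ((r : ℕ) → (n C 2) ^ (k ∸ 1) * n ^ 2 * ((k + 1) C 2) ≤ r → ZF ⊢ (RRT (2 * k) r ⇒ AC⁻ n))
    × (ZF ⊢ (RRT 2 3 ⇒ AC⁻ 3))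
proposition3p3 (suc m) n@(suc (suc n′)) (suc k) (s≤s _) 2≤n@(s≤s (s≤s _)) (s≤s _) =
  (entailment _ _ λ 𝔐 sound rrt → let open Model 𝔐 sound in
    choice-principle 1 λ A infA sizes U hU X G →
      Family.selector-two 1 A infA sizes U hU X G refl m n 2≤n rrt) ,
  -- The exponent k of the statement is `suc k` here. One single fibre is used, and the coefficient
  -- is C(p + 1, 1) with p = `suc k`.
  (λ r bound → subst (λ i → ZF ⊢ (RRT i r ⇒ AC⁻ n)) (odd k)
    (RRT⇒AC⁻ n′ (suc k) 0 r (subst (_≤ r)
      (trans (rearrange (c ^ suc k) n (suc k + 1))
        (cong (λ i → i * c ^ suc k * n ^ 1) (sym (nC1≡n (suc k + 1)))))
      bound))) ,
  -- An even m leaves an even number of single fibres; two is the least positive one, so p drops to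
  -- `k`, one below the statement's value.
  (λ r bound → subst (λ i → ZF ⊢ (RRT i r ⇒ AC⁻ n)) (even k)
    (RRT⇒AC⁻ n′ k 1 r (subst (_≤ r)
      (trans (rearrange₂ (c ^ k) (n ^ 2) ((suc k + 1) C 2))
        (cong (λ i → (i C 2) * c ^ k * n ^ 2) (sym (+-suc k 1))))
      bound))) ,
  (entailment _ _ λ 𝔐 sound rrt → let open Model 𝔐 sound in
    choice-principle 2 λ A infA sizes U hU X G →
      Family.selector-three 2 A infA sizes U hU X G refl rrt)
  where
  c = n C 2
  odd : ∀ k → suc k + suc k + 1 ≡ 2 * suc k + 1
  odd = solve-∀
  even : ∀ k → k + k + 2 ≡ 2 * suc k
  even = solve-∀
  rearrange : ∀ a b d → a * b * d ≡ d * a * (b * 1)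
  rearrange = solve-∀
  rearrange₂ : ∀ a b d → a * b * d ≡ d * a * b
  rearrange₂ = solve-∀
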